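{- Let $\mathcal{V}$ be any variety of modal algebras that is closed under canonical extensions and not weakly transitive (i.e. for every $n\in\mathbb{N}$, $\mathcal{V}\not\models\boxdot^{n+1}x\approx\boxdot^n x$, where $\boxdot x:=\Box x\wedge x$). Then $\mathcal{V}$ is not coherent, $\mathcal{V}$ does not admit right uniform deductive interpolation, and the first-order theory of $\mathcal{V}$ does not have a model completion.
   Context: A modal algebra is a Boolean algebra $\langle A,\wedge,\vee,\neg,0,1\rangle$ with a unary operation $\Box$ satisfying $\Box 1=1$ and $\Box(x\wedge y)=\Box x\wedge\Box y$. $\boxdot^0x=x$, $\boxdot^{k+1}x=\boxdot(\boxdot^kx)$. Canonical extensions. A completion of a poset $P$ is a complete lattice $C$ with an order embedding of $P$ into $C$ preserving all existing finite meets and joins; $P$ is identified with its image. An element of $C$ is open (resp. closed) if it is a join (resp. meet) in $C$ of a nonempty subset of $P$; $O$ and $K$ denote the sets of open and closed elements. The completion is dense if every element of $C$ is both a join of closed elements and a meet of open elements; it is compact if for all nonempty $A\subseteq K$, $B\subseteq O$: $\bigwedge A\le\bigvee B$ iff $\bigwedge A_0\le\bigvee B_0$ for some finite nonempty $A_0\subseteq A$, $B_0\subseteq B$. A dense compact completion is called the canonical extension $P^\sigma$ of $P$ (unique up to isomorphism fixing $P$). For a modal algebra $\mathbf{A}$, $\mathbf{A}^\sigma$ is the canonical extension of its Boolean reduct (a Boolean algebra) with $$\Box^\pi(x)=\bigwedge\bigl\{\bigvee\{\Box a\mid a\in A,\ p\le a\le q\}\mid p\in K,\ q\in O,\ p\le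 x\le q\bigr\}.$$ $\mathcal{V}$ is closed under canonical extensions if $\mathbf{A}\in\mathcal{V}$ implies $\mathbf{A}^\sigma\in\mathcal{V}$. $\mathcal{V}$ is coherent if every finitely generated subalgebra of a finitely presented member of $\mathcal{V}$ is finitely presented (finitely presented: isomorphic to a quotient of a finitely generated free algebra of $\mathcal{V}$ by a finitely generated congruence). $\Sigma\models_{\mathcal{V}}\varepsilon$ means that every assignment of the variables into any member of $\mathcal{V}$ satisfying all equations in $\Sigma$ satisfies $\varepsilon$. $\mathcal{V}$ admits right uniform deductive interpolation if for any finite disjoint sets of variables $\overline{x},\overline{y}$ and finite set $\Sigma$ of equations in variables $\overline{x},\overline{y}$, there is a finite set $\Pi$ of equations in variables $\overline{y}$ such that for every equation $\varepsilon$ whose variables lie in $\overline{y}$ and a set $\overline{z}$ disjoint from $\overline{x},\overline{y}$: $\Sigma\models_{\mathcal{V}}\varepsilon\iff\Pi\models_{\mathcal{V}}\varepsilon$. A model completion of a theory $T$ is a theory $T^*\supseteq T$ in the same language such that every model of $T$ embeds into a model of $T^*$ and, for every model $M$ of $T$, $T^*$ together with the quantifier-free diagram of $M$ is a complete theory. -}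

module Defs where

open import Level using (0ℓ) renaming (suc to lsuc)
open import Algebra.Core using (Op₁; Op₂)
open import Algebra.Definitions using (Congruent₁; Congruent₂)
open import Algebra.Lattice.Bundles using (BooleanAlgebra)
open import Algebra.Lattice.Structures using (IsBooleanAlgebra)
import Algebra.Lattice.Properties.Lattice as LatticeProperties
open import Data.Empty using () renaming (⊥ to Empty)
open import Data.Fin using (Fin)
open import Data.List using (List; _++_)
open import Data.List.Membership.Propositional using () renaming (_∈_ to _∈ˡ_; _∉_ to _∉ˡ_)
open import Data.List.NonEmpty using (List⁺; toList)
open import Data.List.Relation.Binary.Disjoint.Propositional using (Disjoint)
open import Data.List.Relation.Unary.All using (All)
open import Data.Nat using (ℕ; zero; suc)
open import Data.Product using (Σ; ∃; ∃-syntax; _×_; _,_; proj₁; proj₂)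
open import Data.Sum using (_⊎_; inj₁; inj₂; [_,_]′)
open import Data.Unit using () renaming (⊤ to Unit)
open import Data.Vec.Functional using () renaming (_∷_ to _∷ᵉ_)
open import Function using (id; _⇔_)
open import Function.Definitions using (Injective; Surjective)
open import Relation.Binary using (Rel; Poset; IsEquivalence)
open import Relation.Binary.Morphism.Structures using (IsOrderMonomorphism)
open import Relation.Binary.PropositionalEquality using (_≡_)
open import Relation.Unary using (Pred; _∈_; _⊆_; Satisfiable)

-- A set is a setoid in Set, and a subset is a predicate valued in Set.
-- The theorem assumes excluded middle at every level, under which
-- predicates valued in Set₁ (such as being closed or open) are equivalent
-- to predicates valued in Set, so that restricting quantification over
-- subsets to the latter loses nothing.
record Structure : Set₁ where
  infix  8 ~_ □_
  infixr 7 _∧_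
  infixr 6 _∨_
  infix  4 _≈_
  field
    Carrier       : Set
    _≈_           : Rel Carrier 0ℓ
    _∧_ _∨_       : Op₂ Carrier
    ~_ □_         : Op₁ Carrier
    ⊤ ⊥           : Carrier
    isEquivalence : IsEquivalence _≈_
    ∧-cong        : Congruent₂ _≈_ _∧_
    ∨-cong        : Congruent₂ _≈_ _∨_
    ~-cong        : Congruent₁ _≈_ ~_
    □-cong        : Congruent₁ _≈_ □_

open Structure using (Carrier)

HasBooleanReduct : Structure → Set
HasBooleanReduct A = IsBooleanAlgebra _≈_ _∨_ _∧_ ~_ ⊤ ⊥
  where open Structure A

record IsModalAlgebra (A : Structure) : Set where
  open Structure A
  field
    isBooleanAlgebra : HasBooleanReduct A
    □-⊤              : □ ⊤ ≈ ⊤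
    □-∧              : ∀ x y → □ (x ∧ y) ≈ □ x ∧ □ y

-- The order of the Boolean reduct: x ≤ y means x ≈ x ∧ y.
orderOf : (A : Structure) → HasBooleanReduct A → Poset 0ℓ 0ℓ 0ℓ
orderOf A isBA = LatticeProperties.poset (BooleanAlgebra.lattice reduct)
  where
  reduct : BooleanAlgebra 0ℓ 0ℓ
  reduct = record { isBooleanAlgebra = isBA }

record IsHomomorphism (A B : Structure) (f : Carrier A → Carrier B) : Set where
  private
    module A = Structure A
    module B = Structure B
  field
    cong   : ∀ {x y} → x A.≈ y → f x B.≈ f y
    ∧-homo : ∀ x y → f (x A.∧ y) B.≈ f x B.∧ f y
    ∨-homo : ∀ x y → f (x A.∨ y) B.≈ f x B.∨ f y
    ~-homo : ∀ x → f (A.~ x) B.≈ B.~ f x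
    □-homo : ∀ x → f (A.□ x) B.≈ B.□ f x
    ⊤-homo : f A.⊤ B.≈ B.⊤
    ⊥-homo : f A.⊥ B.≈ B.⊥

IsEmbedding : (A B : Structure) → (Carrier A → Carrier B) → Set
IsEmbedding A B f =
  IsHomomorphism A B f × Injective (Structure._≈_ A) (Structure._≈_ B) f

_Isomorphic_ : Structure → Structure → Set
A Isomorphic B = ∃[ f ]
  IsEmbedding A B f × Surjective (Structure._≈_ A) (Structure._≈_ B) f

infix  8 ~ᵗ_ □ᵗ_ ⊡_
infixr 7 _∧ᵗ_
infixr 6 _∨ᵗ_

data Term (X : Set) : Set where
  var       : X → Term X
  _∧ᵗ_ _∨ᵗ_ : Term X → Term X → Term X
  ~ᵗ_ □ᵗ_   : Term X → Term X
  ⊤ᵗ ⊥ᵗ     : Term X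

⊡_ : ∀ {X} → Term X → Term X
⊡ t = □ᵗ t ∧ᵗ t

⊡^ : ∀ {X} → ℕ → Term X → Term X
⊡^ zero    t = t
⊡^ (suc k) t = ⊡ (⊡^ k t)

module _ (A : Structure) where
  open Structure A hiding (Carrier)

  ⟦_⟧ : ∀ {X} → Term X → (X → Carrier A) → Carrier A
  ⟦ var x ⟧  v = v x
  ⟦ s ∧ᵗ t ⟧ v = ⟦ s ⟧ v ∧ ⟦ t ⟧ v
  ⟦ s ∨ᵗ t ⟧ v = ⟦ s ⟧ v ∨ ⟦ t ⟧ v
  ⟦ ~ᵗ t ⟧   v = ~ ⟦ t ⟧ v
  ⟦ □ᵗ t ⟧   v = □ ⟦ t ⟧ v
  ⟦ ⊤ᵗ ⟧     v = ⊤
  ⟦ ⊥ᵗ ⟧     v = ⊥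

Equation : Set → Set
Equation X = Term X × Term X

infix 5 _≋_
pattern _≋_ s t = s , t

_,_⊨ᵉ_ : (A : Structure) {X : Set} → (X → Carrier A) → Equation X → Set
A , v ⊨ᵉ (s ≋ t) = Structure._≈_ A (⟦_⟧ A s v) (⟦_⟧ A t v)

-- A variety of modal algebras is given by a set of equations over
-- countably many variables, added to the axioms of modal algebras.
Variety : Set₁
Variety = Pred (Equation ℕ) 0ℓ

_∈ᵛ_ : Structure → Variety → Set
A ∈ᵛ V = IsModalAlgebra A × (∀ ε → ε ∈ V → ∀ v → A , v ⊨ᵉ ε)

_⊨ᵛ_ : {X : Set} → Variety → Equation X → Set₁
V ⊨ᵛ ε = ∀ A → A ∈ᵛ V → ∀ v → A , v ⊨ᵉ ε

WeaklyTransitive : Variety → Set₁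
WeaklyTransitive V = ∃[ n ] V ⊨ᵛ (⊡^ (suc n) x ≋ ⊡^ n x)
  where
  x : Term Unit
  x = var _

module _ (P : Poset 0ℓ 0ℓ 0ℓ) where
  open Poset P renaming (Carrier to |P|)

  IsSup IsInf : ∀ {ℓ} → Pred |P| ℓ → |P| → Set ℓ
  IsSup S m = (∀ x → x ∈ S → x ≤ m) × (∀ u → (∀ x → x ∈ S → x ≤ u) → m ≤ u)
  IsInf S m = (∀ x → x ∈ S → m ≤ x) × (∀ l → (∀ x → x ∈ S → l ≤ x) → l ≤ m)

  record IsCompleteLattice : Set₁ where
    field
      supremum : (S : Pred |P| 0ℓ) → ∃ (IsSup S)
      infimum  : (S : Pred |P| 0ℓ) → ∃ (IsInf S)

    ⋁ ⋀ : Pred |P| 0ℓ → |P|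
    ⋁ S = proj₁ (supremum S)
    ⋀ S = proj₁ (infimum S)

module _ (P C : Poset 0ℓ 0ℓ 0ℓ) (e : Poset.Carrier P → Poset.Carrier C) where
  private
    module P = Poset P
    module C = Poset C

  Image : ∀ {ℓ} → Pred P.Carrier ℓ → Pred C.Carrier ℓ
  Image S c = ∃[ p ] p ∈ S × e p C.≈ c

  IsOpen IsClosed : Pred C.Carrier (lsuc 0ℓ)
  IsOpen   c = ∃[ S ] Satisfiable S × IsSup C (Image S) c
  IsClosed c = ∃[ S ] Satisfiable S × IsInf C (Image S) c

  -- Finite subsets are represented by lists; the empty meet and join are
  -- included.
  record IsCompletion : Set₁ where
    field
      isCompleteLattice : IsCompleteLattice C
      isOrderEmbedding  : IsOrderMonomorphism P._≈_ C._≈_ P._≤_ C._≤_ e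
      preservesMeets    : ∀ (xs : List P.Carrier) m →
                          IsInf P (_∈ˡ xs) m → IsInf C (Image (_∈ˡ xs)) (e m)
      preservesJoins    : ∀ (xs : List P.Carrier) m →
                          IsSup P (_∈ˡ xs) m → IsSup C (Image (_∈ˡ xs)) (e m)

    open IsCompleteLattice isCompleteLattice public

  record IsCanonicalCompletion : Set₁ where
    field
      isCompletion : IsCompletion

    open IsCompletion isCompletion public

    field
      joinDense : ∀ x → ∃[ S ] S ⊆ IsClosed × IsSup C {0ℓ} S x
      meetDense : ∀ x → ∃[ S ] S ⊆ IsOpen   × IsInf C {0ℓ} S x
      compact   : ∀ (A B : Pred C.Carrier 0ℓ) → Satisfiable A → Satisfiable B →
                  A ⊆ IsClosed → B ⊆ IsOpen →
                  ⋀ A C.≤ ⋁ B ⇔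
                  (∃[ A₀ ] ∃[ B₀ ]
                    (_∈ˡ toList A₀) ⊆ A × (_∈ˡ toList B₀) ⊆ B ×
                    ⋀ (_∈ˡ toList A₀) C.≤ ⋁ (_∈ˡ toList B₀))

module _ (A B : Structure) (A-boolean : HasBooleanReduct A)
         (B-boolean : HasBooleanReduct B) (e : Carrier A → Carrier B) where
  private
    P = orderOf A A-boolean
    C = orderOf B B-boolean
  open Structure A using (□_)
  open Poset C using (_≤_)

  -- The joins ⋁ { □ a ∣ a ∈ A, p ≤ a ≤ q } with p closed, q open and
  -- p ≤ x ≤ q; □π x is their meet.
  □π-Approximants : Carrier B → Pred (Carrier B) (lsuc 0ℓ)
  □π-Approximants x j = ∃[ p ] ∃[ q ]
    IsClosed P C e p × IsOpen P C e q × p ≤ x × x ≤ q ×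
    IsSup C (λ c → ∃[ a ] p ≤ e a × e a ≤ q × Structure._≈_ B (e (□ a)) c) j

-- B is the canonical extension of A, up to isomorphism over A.
record CanonicalExtension (A B : Structure) : Set₁ where
  field
    A-boolean             : HasBooleanReduct A
    B-boolean             : HasBooleanReduct B
    e                     : Carrier A → Carrier B
    isCanonicalCompletion :
      IsCanonicalCompletion (orderOf A A-boolean) (orderOf B B-boolean) e
    □-isπ                 : ∀ x →
      IsInf (orderOf B B-boolean) (□π-Approximants A B A-boolean B-boolean e x)
            (Structure.□_ B x)

-- Canonical extensions are unique up to isomorphism and varieties are
-- closed under isomorphism, so quantifying over all of them is harmless.
ClosedUnderCanonicalExtensions : Variety → Set₁
ClosedUnderCanonicalExtensions V =
  ∀ A B → A ∈ᵛ V → CanonicalExtension A B → B ∈ᵛ V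

IsFree : Variety → {X : Set} (F : Structure) → (X → Carrier F) → Set₁
IsFree V {X} F η = F ∈ᵛ V ×
  (∀ A → A ∈ᵛ V → (v : X → Carrier A) → let open Structure A using (_≈_) in
    ∃[ h ] IsHomomorphism F A h × (∀ x → h (η x) ≈ v x) ×
      (∀ g → IsHomomorphism F A g → (∀ x → g (η x) ≈ v x) → ∀ a → g a ≈ h a))

-- The congruence on A generated by R.
data Cg (A : Structure) (R : Rel (Carrier A) 0ℓ) : Rel (Carrier A) 0ℓ where
  incl   : ∀ {x y} → R x y → Cg A R x y
  refl   : ∀ {x y} → Structure._≈_ A x y → Cg A R x y
  sym    : ∀ {x y} → Cg A R x y → Cg A R y x
  trans  : ∀ {x y z} → Cg A R x y → Cg A R y z → Cg A R x z
  ∧-cong : Congruent₂ (Cg A R) (Structure._∧_ A)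
  ∨-cong : Congruent₂ (Cg A R) (Structure._∨_ A)
  ~-cong : Congruent₁ (Cg A R) (Structure.~_ A)
  □-cong : Congruent₁ (Cg A R) (Structure.□_ A)

_/Cg_ : (A : Structure) → Rel (Carrier A) 0ℓ → Structure
A /Cg R = record
  { Carrier = Carrier A ; _≈_ = Cg A R
  ; _∧_ = _∧_ ; _∨_ = _∨_ ; ~_ = ~_ ; □_ = □_ ; ⊤ = ⊤ ; ⊥ = ⊥
  ; isEquivalence = record
    { refl = refl (IsEquivalence.refl isEquivalence) ; sym = sym ; trans = trans }
  ; ∧-cong = ∧-cong ; ∨-cong = ∨-cong ; ~-cong = ~-cong ; □-cong = □-cong
  }
  where open Structure A using (_∧_; _∨_; ~_; □_; ⊤; ⊥; isEquivalence)

FinitelyPresented : Variety → Structure → Set₁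
FinitelyPresented V A =
  ∃[ n ] ∃[ F ] Σ (Fin n → Carrier F) λ η → IsFree V F η ×
  (Σ (List (Carrier F × Carrier F)) λ R →
    A Isomorphic (F /Cg (λ x y → (x , y) ∈ˡ R)))

-- The smallest subuniverse of A containing the range of g.
data Generated (A : Structure) {I : Set} (g : I → Carrier A) : Pred (Carrier A) 0ℓ where
  gen  : ∀ i → Generated A g (g i)
  resp : ∀ {x y} → Structure._≈_ A x y → Generated A g x → Generated A g y
  ∧-closed : ∀ {x y} → Generated A g x → Generated A g y → Generated A g (Structure._∧_ A x y)
  ∨-closed : ∀ {x y} → Generated A g x → Generated A g y → Generated A g (Structure._∨_ A x y)
  ~-closed : ∀ {x} → Generated A g x → Generated A g (Structure.~_ A x)
  □-closed : ∀ {x} → Generated A g x → Generated A g (Structure.□_ A x)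
  ⊤-closed : Generated A g (Structure.⊤ A)
  ⊥-closed : Generated A g (Structure.⊥ A)

Sub : (A : Structure) {I : Set} → (I → Carrier A) → Structure
Sub A g = record
  { Carrier = ∃ (Generated A g)
  ; _≈_ = λ (x , _) (y , _) → x ≈ y
  ; _∧_ = λ (x , p) (y , q) → x ∧ y , ∧-closed p q
  ; _∨_ = λ (x , p) (y , q) → x ∨ y , ∨-closed p q
  ; ~_ = λ (x , p) → ~ x , ~-closed p
  ; □_ = λ (x , p) → □ x , □-closed p
  ; ⊤ = ⊤ , ⊤-closed
  ; ⊥ = ⊥ , ⊥-closed
  ; isEquivalence = record
    { refl = A.refl ; sym = A.sym ; trans = A.trans }
  ; ∧-cong = S.∧-cong ; ∨-cong = S.∨-cong ; ~-cong = S.~-cong ; □-cong = S.□-cong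
  }
  where
  open module S = Structure A using (_≈_; _∧_; _∨_; ~_; □_; ⊤; ⊥)
  module A = IsEquivalence S.isEquivalence

Coherent : Variety → Set₁
Coherent V = ∀ A → A ∈ᵛ V → FinitelyPresented V A →
  ∀ k (g : Fin k → Carrier A) → FinitelyPresented V (Sub A g)

VarsIn : ∀ {X} → Pred X 0ℓ → Term X → Set
VarsIn Y (var x)  = x ∈ Y
VarsIn Y (s ∧ᵗ t) = VarsIn Y s × VarsIn Y t
VarsIn Y (s ∨ᵗ t) = VarsIn Y s × VarsIn Y t
VarsIn Y (~ᵗ t)   = VarsIn Y t
VarsIn Y (□ᵗ t)   = VarsIn Y t
VarsIn Y ⊤ᵗ       = Unit
VarsIn Y ⊥ᵗ       = Unit

EqVarsIn : ∀ {X} → Pred X 0ℓ → Equation X → Set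
EqVarsIn Y (s ≋ t) = VarsIn Y s × VarsIn Y t

_⊨[_]_ : ∀ {X} → List (Equation X) → Variety → Equation X → Set₁
Γ ⊨[ V ] ε = ∀ A → A ∈ᵛ V → ∀ v → All (A , v ⊨ᵉ_) Γ → A , v ⊨ᵉ ε

RightUniformDeductiveInterpolation : Variety → Set₁
RightUniformDeductiveInterpolation V =
  ∀ (xs ys : List ℕ) → Disjoint xs ys →
  ∀ (Γ : List (Equation ℕ)) → All (EqVarsIn (_∈ˡ xs ++ ys)) Γ →
  ∃[ Π ] All (EqVarsIn (_∈ˡ ys)) Π ×
    (∀ (ε : Equation ℕ) (zs : Pred ℕ 0ℓ) →
      (∀ {z} → z ∈ zs → z ∉ˡ xs ++ ys) →
      EqVarsIn (λ u → u ∈ˡ ys ⊎ u ∈ zs) ε →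
      Γ ⊨[ V ] ε ⇔ Π ⊨[ V ] ε)

-- First-order formulas in the signature of modal algebras expanded by
-- constants from C, with n free (de Bruijn) variables.  The remaining
-- connectives and ∃ are classically definable.
infix  5 _≐_
infixr 4 _⇒_

data Formula (C : Set) (n : ℕ) : Set where
  _≐_    : Term (C ⊎ Fin n) → Term (C ⊎ Fin n) → Formula C n
  ⊥ᶠ     : Formula C n
  _⇒_    : Formula C n → Formula C n → Formula C n
  ∀ᶠ     : Formula C (suc n) → Formula C n

Sentence : Set → Set
Sentence C = Formula C 0

¬ᶠ_ : ∀ {C n} → Formula C n → Formula C n
¬ᶠ φ = φ ⇒ ⊥ᶠ

module _ {C D : Set} (f : C → D) where
  renameᵗ : ∀ {n} → Term (C ⊎ Fin n) → Term (D ⊎ Fin n)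
  renameᵗ (var (inj₁ c)) = var (inj₁ (f c))
  renameᵗ (var (inj₂ i)) = var (inj₂ i)
  renameᵗ (s ∧ᵗ t) = renameᵗ s ∧ᵗ renameᵗ t
  renameᵗ (s ∨ᵗ t) = renameᵗ s ∨ᵗ renameᵗ t
  renameᵗ (~ᵗ t)   = ~ᵗ renameᵗ t
  renameᵗ (□ᵗ t)   = □ᵗ renameᵗ t
  renameᵗ ⊤ᵗ       = ⊤ᵗ
  renameᵗ ⊥ᵗ       = ⊥ᵗ

  rename : ∀ {n} → Formula C n → Formula D n
  rename (s ≐ t) = renameᵗ s ≐ renameᵗ t
  rename ⊥ᶠ      = ⊥ᶠ
  rename (φ ⇒ ψ) = rename φ ⇒ rename ψ
  rename (∀ᶠ φ)  = ∀ᶠ (rename φ)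

module _ (A : Structure) {C : Set} (c : C → Carrier A) where
  open Structure A using (_≈_)

  Sat : ∀ {n} → (Fin n → Carrier A) → Formula C n → Set
  Sat ρ (s ≐ t) = ⟦_⟧ A s [ c , ρ ]′ ≈ ⟦_⟧ A t [ c , ρ ]′
  Sat ρ ⊥ᶠ      = Empty
  Sat ρ (φ ⇒ ψ) = Sat ρ φ → Sat ρ ψ
  Sat ρ (∀ᶠ φ)  = ∀ a → Sat (a ∷ᵉ ρ) φ

  _⊨ˢ_ : Sentence C → Set
  _⊨ˢ_ = Sat λ ()

Theory : Set → Set₂
Theory C = Pred (Sentence C) (lsuc 0ℓ)

IsModel : {C : Set} → Theory C → (A : Structure) → (C → Carrier A) → Set₁
IsModel T A c = ∀ φ → φ ∈ T → _⊨ˢ_ A c φ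

_⊨ᵀ_ : {C : Set} → Theory C → Sentence C → Set₁
T ⊨ᵀ φ = ∀ A c → IsModel T A c → _⊨ˢ_ A c φ

-- A complete theory is in particular required to be satisfiable.
IsComplete : {C : Set} → Theory C → Set₁
IsComplete T =
  (∃[ A ] ∃[ c ] IsModel T A c) × (∀ φ → T ⊨ᵀ φ ⊎ T ⊨ᵀ (¬ᶠ φ))

noConstants : {A : Set} → Empty → A
noConstants ()

_⊨ᴸ_ : Structure → Theory Empty → Set₁
A ⊨ᴸ T = IsModel T A noConstants

FirstOrderTheory : Variety → Theory Empty
FirstOrderTheory V φ = ∀ A → A ∈ᵛ V → _⊨ˢ_ A noConstants φ

QuantifierFree : ∀ {C n} → Formula C n → Set
QuantifierFree (s ≐ t) = Unit
QuantifierFree ⊥ᶠ      = Unit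
QuantifierFree (φ ⇒ ψ) = QuantifierFree φ × QuantifierFree ψ
QuantifierFree (∀ᶠ φ)  = Empty

-- T together with the quantifier-free diagram of M, in which every
-- element of M is named by itself.
_+Diagram_ : Theory Empty → (M : Structure) → Theory (Carrier M)
(T +Diagram M) φ =
  (∃[ ψ ] ψ ∈ T × φ ≡ rename noConstants ψ)
  ⊎ (QuantifierFree φ × _⊨ˢ_ M id φ)

record IsModelCompletion (T* T : Theory Empty) : Set₁ where
  field
    extends  : T ⊆ T*
    embeds   : ∀ M → M ⊨ᴸ T → ∃[ N ] N ⊨ᴸ T* × ∃ (IsEmbedding M N)
    complete : ∀ M → M ⊨ᴸ T → IsComplete (T* +Diagram M)

HasModelCompletion : Theory Empty → Set₂
HasModelCompletion T = ∃[ T* ] IsModelCompletion T* T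

{-# OPTIONS --safe #-}

-- Let P∞ be the algebra of V generated by y and z subject to y ≤ ⊡^k z for
-- all k, and P n the one where this is only required for k ≤ n.  The meet of
-- the ⊡^k z in the canonical extension of P∞ is a fixpoint of ⊡, because by
-- compactness □^π preserves it.  So the equations in y and z that follow from
-- "y ≤ x ≤ z for some fixpoint x of ⊡" are exactly those valid in P∞.  A
-- uniform interpolant, a finite presentation, or (by compactness of
-- first-order logic) a model completion would make finitely many of the
-- y ≤ ⊡^k z imply all of them.  But y ≤ ⊡^n z does not imply
-- y ≤ ⊡^(n+1) z, as the substitution y = ⊡^n z would yield weak transitivity.

module Submission where

open import Defs hiding (incl; refl; sym; trans; ∧-cong; ∨-cong; ~-cong; □-cong; ∧-closed; ∨-closed; ~-closed; □-closed; resp)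
open import Algebra.Lattice.Bundles using (BooleanAlgebra)
open import Algebra.Lattice.Structures using (IsBooleanAlgebra; IsDistributiveLattice; IsLattice)
import Algebra.Lattice.Properties.BooleanAlgebra as BooleanAlgebraProperties
import Algebra.Lattice.Properties.Lattice as LatticeProperties
open import Axiom.ExcludedMiddle using (ExcludedMiddle)
open import Data.Bool using (Bool; true; false; not; if_then_else_)
  renaming (_∧_ to _&&_; _∨_ to _||_)
import Data.Bool.Properties as Bool
open import Data.Empty using (⊥-elim) renaming (⊥ to Empty)
open import Data.Fin using (Fin; zero; suc)
open import Data.List using (List; []; _∷_; _++_; foldr)
open import Data.List.NonEmpty using (toList) renaming (_∷_ to _∷⁺_)
open import Data.List.Membership.Propositional using () renaming (_∈_ to _∈ˡ_)
open import Data.List.Relation.Unary.All using (All; []; _∷_)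
import Data.List.Relation.Unary.All as All
import Data.List.Relation.Unary.All.Properties as All
open import Data.List.Relation.Unary.Any using (here; there)
open import Data.Maybe using (Maybe; just; nothing)
import Data.Maybe as Maybe
open import Data.Maybe.Properties using (just-injective)
open import Data.Nat using (ℕ; zero; suc; _+_; _⊔_; z≤n; _≤′_; ≤′-refl; ≤′-step) renaming (_≤_ to _≤ᴺ_)
import Data.Nat.Properties as ℕ
open import Data.Product using (Σ; ∃-syntax; _×_; _,_; proj₁; proj₂)
open import Data.Sum using (_⊎_; inj₁; inj₂; [_,_]′)
open import Data.Unit using (tt) renaming (⊤ to Unit)
open import Data.Vec using (Vec; []; _∷_; tabulate)
open import Data.Vec.Functional using () renaming (_∷_ to _∷ᵉ_)
open import Function using (id; _∘_; _⇔_; mk⇔; Equivalence)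
open import Level using (0ℓ) renaming (suc to lsuc; _⊔_ to _⊔ˡ_)
open import Relation.Binary using (Rel; Poset; IsEquivalence)
import Relation.Binary.Lattice as OrderLattice
import Relation.Binary.Reasoning.Setoid as SetoidReasoning
open import Relation.Binary.PropositionalEquality as ≡ using (_≡_; refl)
open import Relation.Nullary using (¬_; Dec; yes; no; does)
open import Relation.Unary using (Pred; _∈_; _⊆_; Satisfiable)

-- Excluded middle is the only classical assumption, and algebras, subsets and points have to stay
-- in `Set` although validity in `V` and closedness live in `Set₁`. Truth values in `Bool` settle
-- the levels. Countability takes the place of Zorn's lemma: `P∞` is a quotient of the terms in two
-- variables, and there are countably many formulas with parameters from it, so that ultrafilters
-- can be built step by step along an enumeration.
--
-- For the model completion, the sentence at stake says that no fixpoint of `⊡` lies between `y` and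
-- `z`, with parameters from `P∞`. It is true in any model of `T*` that extends `P n`, where a
-- fixpoint would give the missing bound, and false in any model that extends the canonical
-- extension of `P∞`. The models over the `P n` have a limit that satisfies both `T*` and the
-- diagram of `P∞`, so `T*` with this diagram does not decide the sentence.

module Classical (em : ∀ ℓ → ExcludedMiddle ℓ) where

  -- The truth value lowers the universe level: a statement in `Set₁`, such as validity in `V`,
  -- becomes data in `Set`.
  ⌞_⌟ : ∀ {ℓ} → Set ℓ → Bool
  ⌞ P ⌟ = does (em _ {P})

  ⌞⌟-sound : ∀ {ℓ} {P : Set ℓ} → ⌞ P ⌟ ≡ true → P
  ⌞⌟-sound {P = P} eq with em _ {P}
  ... | yes p = p

  ⌞⌟-complete : ∀ {ℓ} {P : Set ℓ} → P → ⌞ P ⌟ ≡ true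
  ⌞⌟-complete {P = P} p with em _ {P}
  ... | yes _ = refl
  ... | no ¬p = ⊥-elim (¬p p)

  by-contradiction : ∀ {ℓ} {P : Set ℓ} → ¬ ¬ P → P
  by-contradiction {P = P} ¬¬p with em _ {P}
  ... | yes p = p
  ... | no ¬p = ⊥-elim (¬¬p ¬p)

-- Boolean truth values

false≢true : ¬ false ≡ true
false≢true ()

≡-from-⇔ : ∀ {a b} → (a ≡ true → b ≡ true) → (b ≡ true → a ≡ true) → a ≡ b
≡-from-⇔ {true}  {b}     f g = ≡.sym (f refl)
≡-from-⇔ {false} {true}  f g = g refl
≡-from-⇔ {false} {false} f g = refl

&&-true : ∀ {a b} → a ≡ true → b ≡ true → a && b ≡ true
&&-true refl refl = refl

&&-trueˡ : ∀ {a b} → a && b ≡ true → a ≡ true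
&&-trueˡ {true} _ = refl

&&-trueʳ : ∀ {a b} → a && b ≡ true → b ≡ true
&&-trueʳ {true} eq = eq

||-true⁻ : ∀ {a b} → a || b ≡ true → a ≡ true ⊎ b ≡ true
||-true⁻ {true}  _  = inj₁ refl
||-true⁻ {false} eq = inj₂ eq

≢true⇒not : ∀ {a} → ¬ a ≡ true → not a ≡ true
≢true⇒not {true}  a≢ = ⊥-elim (a≢ refl)
≢true⇒not {false} _  = refl

not⇒≢true : ∀ {a} → not a ≡ true → ¬ a ≡ true
not⇒≢true {true} () _

≡&&⇒implies : ∀ {a b} → a ≡ a && b → a ≡ true → b ≡ true
≡&&⇒implies eq refl = ≡.sym eq

implies⇒≡&& : ∀ {a b} → (a ≡ true → b ≡ true) → a ≡ a && b
implies⇒≡&& {true}  f = ≡.sym (f refl)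
implies⇒≡&& {false} f = refl

-- Boolean algebras

module BooleanOrder {c ℓ} (𝔹 : BooleanAlgebra c ℓ) where
  open BooleanAlgebra 𝔹 renaming (¬_ to ~_)
  open BooleanAlgebraProperties 𝔹 public
    using (∧-identityʳ; ∨-identityʳ; ¬-involutive; deMorgan₂; ∧-zeroˡ)
  open OrderLattice.Lattice (LatticeProperties.∨-∧-orderTheoreticLattice lattice) public
    using (x∧y≤x; x∧y≤y; ∧-greatest; x≤x∨y; y≤x∨y; ∨-least)
  open Poset (LatticeProperties.poset lattice) public
    using (_≤_; antisym)
    renaming (refl to ≤-refl; trans to ≤-trans; reflexive to ≤-reflexive)
  open SetoidReasoning setoid

  ∧-mono : ∀ {x y u v} → x ≤ y → u ≤ v → x ∧ u ≤ y ∧ v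
  ∧-mono {x} {y} {u} {v} x≤y u≤v =
    ∧-greatest (≤-trans (x∧y≤x x u) x≤y) (≤-trans (x∧y≤y x u) u≤v)

  x≤⊤ : ∀ x → x ≤ ⊤
  x≤⊤ x = sym (∧-identityʳ x)

  ⊥≤x : ∀ x → ⊥ ≤ x
  ⊥≤x x = sym (∧-zeroˡ x)

  ~-anti : ∀ {x y} → x ≤ y → ~ y ≤ ~ x
  ~-anti {x} {y} x≤y = sym (begin
    ~ y ∧ ~ x    ≈⟨ deMorgan₂ y x ⟨
    ~ (y ∨ x)    ≈⟨ ¬-cong (antisym (∨-least ≤-refl x≤y) (x≤x∨y y x)) ⟩
    ~ y          ∎)

  ~-flip : ∀ {x y} → x ≤ ~ y → y ≤ ~ x
  ~-flip {x} {y} x≤~y = ≤-trans (≤-reflexive (sym (¬-involutive y))) (~-anti x≤~y)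

  ≤-~⇒≤⊥ : ∀ {x y} → x ≤ y → x ≤ ~ y → x ≤ ⊥
  ≤-~⇒≤⊥ {x} {y} x≤y x≤~y =
    ≤-trans (∧-greatest x≤y x≤~y) (≤-reflexive (∧-complementʳ y))

  ∧~≤⊥⇒≤ : ∀ {x y} → x ∧ ~ y ≤ ⊥ → x ≤ y
  ∧~≤⊥⇒≤ {x} {y} p = sym (begin
    x ∧ y                ≈⟨ ∨-identityʳ (x ∧ y) ⟨
    (x ∧ y) ∨ ⊥          ≈⟨ ∨-congˡ (antisym p (⊥≤x _)) ⟨
    (x ∧ y) ∨ (x ∧ ~ y)  ≈⟨ ∧-distribˡ-∨ x y (~ y) ⟨
    x ∧ (y ∨ ~ y)        ≈⟨ ∧-congˡ (∨-complementʳ y) ⟩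
    x ∧ ⊤                ≈⟨ ∧-identityʳ x ⟩
    x                    ∎)

  -- This drives the ultrafilter construction: a filter that contains both complements on the left
  -- contains `~ w`, so a consistent `w` remains consistent with `x` or with `~ x`.
  ~-cases : ∀ w x → ~ (w ∧ x) ∧ ~ (w ∧ ~ x) ≤ ~ w
  ~-cases w x = ≤-reflexive (begin
    ~ (w ∧ x) ∧ ~ (w ∧ ~ x)    ≈⟨ deMorgan₂ _ _ ⟨
    ~ ((w ∧ x) ∨ (w ∧ ~ x))    ≈⟨ ¬-cong (∧-distribˡ-∨ w x (~ x)) ⟨
    ~ (w ∧ (x ∨ ~ x))          ≈⟨ ¬-cong (∧-congˡ (∨-complementʳ x)) ⟩
    ~ (w ∧ ⊤)                  ≈⟨ ¬-cong (∧-identityʳ w) ⟩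
    ~ w                        ∎)

  ⋀ ⋁ : List Carrier → Carrier
  ⋀ = foldr _∧_ ⊤
  ⋁ = foldr _∨_ ⊥

  ⋀-≤ : ∀ {x xs} → x ∈ˡ xs → ⋀ xs ≤ x
  ⋀-≤ (here refl)  = x∧y≤x _ _
  ⋀-≤ (there x∈xs) = ≤-trans (x∧y≤y _ _) (⋀-≤ x∈xs)

  ≤-⋁ : ∀ {x xs} → x ∈ˡ xs → x ≤ ⋁ xs
  ≤-⋁ (here refl)  = x≤x∨y _ _
  ≤-⋁ (there x∈xs) = ≤-trans (≤-⋁ x∈xs) (y≤x∨y _ _)

  ⋀-++ : ∀ xs ys → ⋀ (xs ++ ys) ≤ ⋀ xs ∧ ⋀ ys
  ⋀-++ []       ys = ∧-greatest (x≤⊤ _) ≤-refl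
  ⋀-++ (x ∷ xs) ys = ∧-greatest
    (∧-mono ≤-refl (≤-trans (⋀-++ xs ys) (x∧y≤x _ _)))
    (≤-trans (x∧y≤y _ _) (≤-trans (⋀-++ xs ys) (x∧y≤y _ _)))

-- Filters and ultrafilters

record ProperFilter {c ℓ f} (𝔹 : BooleanAlgebra c ℓ)
                    (F : Pred (BooleanAlgebra.Carrier 𝔹) f) : Set (c ⊔ˡ ℓ ⊔ˡ f) where
  open BooleanAlgebra 𝔹 renaming (¬_ to ~_)
  open BooleanOrder 𝔹
  field
    up       : ∀ {x y} → x ≤ y → x ∈ F → y ∈ F
    ∧-closed : ∀ {x y} → x ∈ F → y ∈ F → x ∧ y ∈ F
    ⊤∈       : ⊤ ∈ F
    ⊥∉       : ¬ ⊥ ∈ F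

module Ultrafilters (em : ∀ ℓ → ExcludedMiddle ℓ) {c ℓ} (𝔹 : BooleanAlgebra c ℓ) where
  open Classical em
  open BooleanAlgebra 𝔹 renaming (¬_ to ~_)
  open BooleanOrder 𝔹

  module _ {f} {F : Pred Carrier f} (filter : ProperFilter 𝔹 F) (a : ℕ → Carrier) where
    open ProperFilter filter

    private
      Consistent : Carrier → Set f
      Consistent x = ¬ (~ x ∈ F)

      -- Lindenbaum's construction. Finitely many choices are recorded by their meet, so a stage is
      -- a single element and consistency with `F` is the single condition that its complement is
      -- not in `F`.
      stage : ℕ → Carrier
      stage zero    = ⊤
      stage (suc k) = if ⌞ Consistent (stage k ∧ a k) ⌟ then stage k ∧ a k else stage k ∧ ~ a k

      stage-consistent : ∀ k → Consistent (stage k)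
      stage-consistent zero ~⊤∈F =
        ⊥∉ (up (≤-~⇒≤⊥ (x≤⊤ _) ≤-refl) ~⊤∈F)
      stage-consistent (suc k) with em _ {Consistent (stage k ∧ a k)}
      ... | yes consistent = consistent
      ... | no ¬consistent = λ ~∈F → stage-consistent k
              (up (~-cases (stage k) (a k)) (∧-closed (by-contradiction ¬consistent) ~∈F))

      stage-decides : ∀ k → stage (suc k) ≤ a k ⊎ stage (suc k) ≤ ~ a k
      stage-decides k with ⌞ Consistent (stage k ∧ a k) ⌟
      ... | true  = inj₁ (x∧y≤y _ _)
      ... | false = inj₂ (x∧y≤y _ _)

      stage-suc : ∀ k → stage (suc k) ≤ stage k
      stage-suc k with ⌞ Consistent (stage k ∧ a k) ⌟
      ... | true  = x∧y≤x _ _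
      ... | false = x∧y≤x _ _

      stage-+ : ∀ j k → stage (j + k) ≤ stage k
      stage-+ zero    k = ≤-refl
      stage-+ (suc j) k = ≤-trans (stage-suc (j + k)) (stage-+ j k)

      U : Pred Carrier _
      U x = ∃[ k ] stage k ≤ x

    -- U need not extend F, but it contains the members of F among the a k,
    -- which are all that it decides.
    ultrafilter-extension :
      ∃[ U ] ProperFilter {f = ℓ} 𝔹 U × (∀ k → a k ∈ F → a k ∈ U) ×
             (∀ k → a k ∈ U ⊎ ~ a k ∈ U)
    ultrafilter-extension = U , U-filter , extends , decides
      where
      U-filter : ProperFilter 𝔹 U
      U-filter = record
        { up       = λ x≤y (k , p) → k , ≤-trans p x≤y
        ; ∧-closed = λ {x} {y} (j , p) (k , q) → j + k , ∧-greatest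
            (≤-trans (≡.subst (λ i → stage i ≤ stage j) (ℕ.+-comm k j) (stage-+ k j)) p)
            (≤-trans (stage-+ j k) q)
        ; ⊤∈       = 0 , ≤-refl
        ; ⊥∉       = λ (k , p) → stage-consistent k
            (up (~-flip (≤-trans p (⊥≤x _))) ⊤∈)
        }

      decides : ∀ k → a k ∈ U ⊎ ~ a k ∈ U
      decides k with stage-decides k
      ... | inj₁ p = inj₁ (suc k , p)
      ... | inj₂ p = inj₂ (suc k , p)

      extends : ∀ k → a k ∈ F → a k ∈ U
      extends k a∈F with stage-decides k
      ... | inj₁ p = suc k , p
      -- Contraposing `p` puts `~ stage (suc k)` above `a k`, hence into `F`, against the
      -- consistency of the stage.
      ... | inj₂ p = ⊥-elim (stage-consistent (suc k) (up (~-flip p) a∈F))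

-- Countable sets

data Tree : Set where
  leaf : Tree
  node : Tree → Tree → Tree

double : ℕ → ℕ
double zero    = zero
double (suc n) = suc (suc (double n))

double-injective : ∀ {m n} → double m ≡ double n → m ≡ n
double-injective {zero}  {zero}  _  = refl
double-injective {suc m} {suc n} eq =
  ≡.cong suc (double-injective (ℕ.suc-injective (ℕ.suc-injective eq)))

odd≢even : ∀ {m n} → ¬ suc (double m) ≡ double n
odd≢even {suc m} {suc n} eq = odd≢even {m} {n} (ℕ.suc-injective (ℕ.suc-injective eq))

-- pair a b = 2^a (2b + 1)
pair : ℕ → ℕ → ℕ
pair zero    b = suc (double b)
pair (suc a) b = double (pair a b)

pair-injective : ∀ a {b} c {d} → pair a b ≡ pair c d → a ≡ c × b ≡ d
pair-injective zero    zero    eq = refl , double-injective (ℕ.suc-injective eq)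
pair-injective zero    {b} (suc c) {d} eq = ⊥-elim (odd≢even {b} {pair c d} eq)
pair-injective (suc a) {b} zero    {d} eq = ⊥-elim (odd≢even {d} {pair a b} (≡.sym eq))
pair-injective (suc a) (suc c) eq with pair-injective a c (double-injective eq)
... | refl , b≡d = refl , b≡d

treeCode : Tree → ℕ
treeCode leaf       = zero
treeCode (node s t) = suc (pair (treeCode s) (treeCode t))

treeCode-injective : ∀ {s t} → treeCode s ≡ treeCode t → s ≡ t
treeCode-injective {leaf}     {leaf}     _  = refl
treeCode-injective {node s t} {node u v} eq
  with pair-injective (treeCode s) (treeCode u) (ℕ.suc-injective eq)
... | s≡u , t≡v = ≡.cong₂ node (treeCode-injective s≡u) (treeCode-injective t≡v)

-- A partial decoder yields injectivity of `encode` by computation, which avoids comparing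
-- constructors pairwise.
record Encoding (X : Set) : Set where
  field
    encode    : X → Tree
    decode    : Tree → Maybe X
    inverse   : ∀ x → decode (encode x) ≡ just x

  encode-injective : ∀ {x y} → encode x ≡ encode y → x ≡ y
  encode-injective {x} {y} eq = just-injective
    (≡.trans (≡.sym (inverse x)) (≡.trans (≡.cong decode eq) (inverse y)))

open Encoding

module Enumeration (em : ∀ ℓ → ExcludedMiddle ℓ) where

  -- Excluded middle decides whether `k` is a code; `default` fills the places where it is not.
  enumeration : ∀ {X} → Encoding X → X → ∃[ a ] (∀ (x : X) → ∃[ k ] a k ≡ x)
  enumeration {X} E default = a , λ x → treeCode (encode E x) , hit x (em _)
    where
    pick : ∀ k → Dec (∃[ x ] treeCode (encode E x) ≡ k) → X
    pick k (yes (x , _)) = x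
    pick k (no _)        = default

    a : ℕ → X
    a k = pick k (em _)

    hit : ∀ x (d : Dec (∃[ y ] treeCode (encode E y) ≡ treeCode (encode E x))) →
          pick _ d ≡ x
    hit x (yes (y , eq)) = encode-injective E (treeCode-injective eq)
    hit x (no ∄)         = ⊥-elim (∄ (x , refl))

pattern #0 = leaf
pattern #1 = node leaf #0
pattern #2 = node leaf #1
pattern #3 = node leaf #2
pattern #4 = node leaf #3
pattern #5 = node leaf #4
pattern #6 = node leaf #5

encodeFin : ∀ {n} → Fin n → Tree
encodeFin zero    = leaf
encodeFin (suc i) = node leaf (encodeFin i)

decodeFin : ∀ n → Tree → Maybe (Fin n)
decodeFin zero    _          = nothing
decodeFin (suc n) leaf       = just zero
decodeFin (suc n) (node _ t) = Maybe.map suc (decodeFin n t)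

finEncoding : ∀ {n} → Encoding (Fin n)
finEncoding = record { encode = encodeFin ; decode = decodeFin _ ; inverse = inverseFin }
  where
  inverseFin : ∀ {n} (i : Fin n) → decodeFin n (encodeFin i) ≡ just i
  inverseFin zero    = refl
  inverseFin (suc i) rewrite inverseFin i = refl

encodeℕ : ℕ → Tree
encodeℕ zero    = leaf
encodeℕ (suc n) = node leaf (encodeℕ n)

decodeℕ : Tree → ℕ
decodeℕ leaf       = zero
decodeℕ (node _ t) = suc (decodeℕ t)

decodeℕ-encodeℕ : ∀ n → decodeℕ (encodeℕ n) ≡ n
decodeℕ-encodeℕ zero    = refl
decodeℕ-encodeℕ (suc n) = ≡.cong suc (decodeℕ-encodeℕ n)

sumEncoding : ∀ {X Y} → Encoding X → Encoding Y → Encoding (X ⊎ Y)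
sumEncoding {X} {Y} E F = record { encode = enc ; decode = dec ; inverse = inv }
  where
  enc : X ⊎ Y → Tree
  enc (inj₁ x) = node #0 (encode E x)
  enc (inj₂ y) = node #1 (encode F y)

  dec : Tree → Maybe (X ⊎ Y)
  dec (node #0 t) = Maybe.map inj₁ (decode E t)
  dec (node #1 t) = Maybe.map inj₂ (decode F t)
  dec _           = nothing

  inv : ∀ x → dec (enc x) ≡ just x
  inv (inj₁ x) rewrite inverse E x = refl
  inv (inj₂ y) rewrite inverse F y = refl

termEncoding : ∀ {X} → Encoding X → Encoding (Term X)
termEncoding {X} E = record { encode = enc ; decode = dec ; inverse = inv }
  where
  enc : Term X → Tree
  enc (var x)  = node #0 (encode E x)
  enc (s ∧ᵗ t) = node #1 (node (enc s) (enc t))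
  enc (s ∨ᵗ t) = node #2 (node (enc s) (enc t))
  enc (~ᵗ t)   = node #3 (enc t)
  enc (□ᵗ t)   = node #4 (enc t)
  enc ⊤ᵗ       = node #5 leaf
  enc ⊥ᵗ       = node #6 leaf

  dec : Tree → Maybe (Term X)
  dec (node #0 t)          = Maybe.map var (decode E t)
  dec (node #1 (node s t)) = Maybe.zipWith _∧ᵗ_ (dec s) (dec t)
  dec (node #2 (node s t)) = Maybe.zipWith _∨ᵗ_ (dec s) (dec t)
  dec (node #3 t)          = Maybe.map ~ᵗ_ (dec t)
  dec (node #4 t)          = Maybe.map □ᵗ_ (dec t)
  dec (node #5 _)          = just ⊤ᵗ
  dec (node #6 _)          = just ⊥ᵗ
  dec _                    = nothing

  inv : ∀ t → dec (enc t) ≡ just t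
  inv (var x)  rewrite inverse E x = refl
  inv (s ∧ᵗ t) rewrite inv s | inv t = refl
  inv (s ∨ᵗ t) rewrite inv s | inv t = refl
  inv (~ᵗ t)   rewrite inv t = refl
  inv (□ᵗ t)   rewrite inv t = refl
  inv ⊤ᵗ       = refl
  inv ⊥ᵗ       = refl

module _ {C : Set} (E : Encoding C) where

  atomEncoding : ∀ {n} → Encoding (Term (C ⊎ Fin n))
  atomEncoding = termEncoding (sumEncoding E finEncoding)

  encodeFormula : ∀ {n} → Formula C n → Tree
  encodeFormula (s ≐ t) = node #0 (node (encode atomEncoding s) (encode atomEncoding t))
  encodeFormula ⊥ᶠ      = node #1 leaf
  encodeFormula (φ ⇒ ψ) = node #2 (node (encodeFormula φ) (encodeFormula ψ))
  encodeFormula (∀ᶠ φ)  = node #3 (encodeFormula φ)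

  decodeFormula : ∀ n → Tree → Maybe (Formula C n)
  decodeFormula n (node #0 (node s t)) =
    Maybe.zipWith _≐_ (decode atomEncoding s) (decode atomEncoding t)
  decodeFormula n (node #1 _)          = just ⊥ᶠ
  decodeFormula n (node #2 (node s t)) =
    Maybe.zipWith _⇒_ (decodeFormula n s) (decodeFormula n t)
  decodeFormula n (node #3 t)          = Maybe.map ∀ᶠ (decodeFormula (suc n) t)
  decodeFormula n _                    = nothing

  formulaEncoding : ∀ {n} → Encoding (Formula C n)
  formulaEncoding = record { encode = encodeFormula ; decode = decodeFormula _ ; inverse = inv }
    where
    inv : ∀ {n} (φ : Formula C n) → decodeFormula n (encodeFormula φ) ≡ just φ
    inv {n} (s ≐ t)
      rewrite inverse (atomEncoding {n}) s | inverse (atomEncoding {n}) t = refl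
    inv ⊥ᶠ      = refl
    inv (φ ⇒ ψ) rewrite inv φ | inv ψ = refl
    inv (∀ᶠ φ)  rewrite inv φ = refl

-- Powersets and canonical extensions

module Powerset (em : ∀ ℓ → ExcludedMiddle ℓ) (P : Set) (_~_ : Rel P 0ℓ) where
  open Classical em

  -- Characteristic functions into `Bool` keep the powerset in `Set`. Invariance under `_~_` is
  -- imposed because two points with the same members need not be propositionally equal.
  Subset : Set
  Subset = Σ (P → Bool) λ S → ∀ {p q} → p ~ q → S p ≡ S q

  private
    infix 4 _≐ˢ_
    _≐ˢ_ : Rel Subset 0ℓ
    S ≐ˢ T = ∀ p → proj₁ S p ≡ proj₁ T p

    isLattice : IsLattice _≐ˢ_
      (λ (S , s) (T , t) → (λ p → S p || T p) , λ r → ≡.cong₂ _||_ (s r) (t r))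
      (λ (S , s) (T , t) → (λ p → S p && T p) , λ r → ≡.cong₂ _&&_ (s r) (t r))
    isLattice = record
      { isEquivalence = record
        { refl  = λ p → refl
        ; sym   = λ f p → ≡.sym (f p)
        ; trans = λ f g p → ≡.trans (f p) (g p)
        }
      ; ∨-comm     = λ S T p → Bool.∨-comm (proj₁ S p) (proj₁ T p)
      ; ∨-assoc    = λ S T U p → Bool.∨-assoc (proj₁ S p) (proj₁ T p) (proj₁ U p)
      ; ∨-cong     = λ f g p → ≡.cong₂ _||_ (f p) (g p)
      ; ∧-comm     = λ S T p → Bool.∧-comm (proj₁ S p) (proj₁ T p)
      ; ∧-assoc    = λ S T U p → Bool.∧-assoc (proj₁ S p) (proj₁ T p) (proj₁ U p)
      ; ∧-cong     = λ f g p → ≡.cong₂ _&&_ (f p) (g p)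
      ; absorptive = (λ S T p → Bool.∨-abs-∧ (proj₁ S p) (proj₁ T p))
                   , (λ S T p → Bool.∧-abs-∨ (proj₁ S p) (proj₁ T p))
      }

    isDistributiveLattice : IsDistributiveLattice _≐ˢ_ _ _
    isDistributiveLattice = record
      { isLattice   = isLattice
      ; ∨-distrib-∧ =
          (λ S T U p → Bool.∨-distribˡ-∧ (proj₁ S p) (proj₁ T p) (proj₁ U p))
        , (λ S T U p → Bool.∨-distribʳ-∧ (proj₁ S p) (proj₁ T p) (proj₁ U p))
      ; ∧-distrib-∨ =
          (λ S T U p → Bool.∧-distribˡ-∨ (proj₁ S p) (proj₁ T p) (proj₁ U p))
        , (λ S T U p → Bool.∧-distribʳ-∨ (proj₁ S p) (proj₁ T p) (proj₁ U p))
      }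

  powerset : BooleanAlgebra 0ℓ 0ℓ
  powerset = record
    { isBooleanAlgebra = record
      { isDistributiveLattice = isDistributiveLattice
      ; ∨-complement = (λ S p → Bool.∨-inverseˡ (proj₁ S p))
                     , (λ S p → Bool.∨-inverseʳ (proj₁ S p))
      ; ∧-complement = (λ S p → Bool.∧-inverseˡ (proj₁ S p))
                     , (λ S p → Bool.∧-inverseʳ (proj₁ S p))
      ; ¬-cong       = λ f p → ≡.cong not (f p)
      }
    ; ¬_ = λ (S , s) → (λ p → not (S p)) , λ {_} {_} r → ≡.cong not (s r)
    ; ⊤  = (λ _ → true)  , λ {_} {_} _ → refl
    ; ⊥  = (λ _ → false) , λ {_} {_} _ → refl
    }

  infix 4 _∋_
  _∋_ : Subset → P → Set
  S ∋ p = proj₁ S p ≡ true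

  order : Poset 0ℓ 0ℓ 0ℓ
  order = LatticeProperties.poset (BooleanAlgebra.lattice powerset)
  open Poset order using (_≤_)

  ≤⇒∋ : ∀ {S T} → S ≤ T → ∀ {p} → S ∋ p → T ∋ p
  ≤⇒∋ S≤T = ≡&&⇒implies (S≤T _)

  ∋⇒≤ : ∀ {S T} → (∀ {p} → S ∋ p → T ∋ p) → S ≤ T
  ∋⇒≤ f p = implies⇒≡&& f

  -- The family may live at any level; `□π` is the intersection of a family in `Set₁`.
  union intersection : ∀ {ℓ} → Pred Subset ℓ → Subset
  union 𝒮 =
    (λ p → ⌞ (∃[ S ] S ∈ 𝒮 × S ∋ p) ⌟) ,
    λ r → ≡-from-⇔ (move r) (move′ r)
    where
    move : ∀ {p q} → p ~ q → ⌞ (∃[ S ] S ∈ 𝒮 × S ∋ p) ⌟ ≡ true →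
           ⌞ (∃[ S ] S ∈ 𝒮 × S ∋ q) ⌟ ≡ true
    move r eq with ⌞⌟-sound eq
    ... | S , S∈ , S∋p = ⌞⌟-complete (S , S∈ , ≡.trans (≡.sym (proj₂ S r)) S∋p)
    move′ : ∀ {p q} → p ~ q → ⌞ (∃[ S ] S ∈ 𝒮 × S ∋ q) ⌟ ≡ true →
            ⌞ (∃[ S ] S ∈ 𝒮 × S ∋ p) ⌟ ≡ true
    move′ r eq with ⌞⌟-sound eq
    ... | S , S∈ , S∋q = ⌞⌟-complete (S , S∈ , ≡.trans (proj₂ S r) S∋q)
  intersection 𝒮 =
    (λ p → ⌞ (∀ S → S ∈ 𝒮 → S ∋ p) ⌟) , λ r → ≡-from-⇔
      (λ eq → ⌞⌟-complete λ S S∈ → ≡.trans (≡.sym (proj₂ S r)) (⌞⌟-sound eq S S∈))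
      (λ eq → ⌞⌟-complete λ S S∈ → ≡.trans (proj₂ S r) (⌞⌟-sound eq S S∈))

  union-isSup : ∀ {ℓ} (𝒮 : Pred Subset ℓ) → IsSup order 𝒮 (union 𝒮)
  union-isSup 𝒮 =
    (λ S S∈ → ∋⇒≤ {S} {union 𝒮} λ S∋p → ⌞⌟-complete (S , S∈ , S∋p)) ,
    λ T T-upper → ∋⇒≤ {union 𝒮} {T} λ ∋p →
      let S , S∈ , S∋p = ⌞⌟-sound ∋p in ≤⇒∋ {S} {T} (T-upper S S∈) S∋p

  intersection-isInf : ∀ {ℓ} (𝒮 : Pred Subset ℓ) → IsInf order 𝒮 (intersection 𝒮)
  intersection-isInf 𝒮 =
    (λ S S∈ → ∋⇒≤ {intersection 𝒮} {S} λ ∋p → ⌞⌟-sound ∋p S S∈) ,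
    λ T T-lower → ∋⇒≤ {T} {intersection 𝒮} λ T∋p →
      ⌞⌟-complete λ S S∈ → ≤⇒∋ {T} {S} (T-lower S S∈) T∋p

  isCompleteLattice : IsCompleteLattice order
  isCompleteLattice = record
    { supremum = λ 𝒮 → union 𝒮 , union-isSup 𝒮
    ; infimum  = λ 𝒮 → intersection 𝒮 , intersection-isInf 𝒮
    }

withBox : (𝔹 : BooleanAlgebra 0ℓ 0ℓ) → let open BooleanAlgebra 𝔹 in
          (□ : Carrier → Carrier) → (∀ {x y} → x ≈ y → □ x ≈ □ y) → Structure
withBox 𝔹 □ □-cong = record
  { Carrier = Carrier ; _≈_ = _≈_ ; _∧_ = _∧_ ; _∨_ = _∨_ ; ~_ = ∁ ; □_ = □ ; ⊤ = ⊤ ; ⊥ = ⊥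
  ; isEquivalence = isEquivalence
  ; ∧-cong = ∧-cong ; ∨-cong = ∨-cong ; ~-cong = ¬-cong ; □-cong = □-cong
  }
  where open BooleanAlgebra 𝔹 renaming (¬_ to ∁)

reduct : (A : Structure) → HasBooleanReduct A → BooleanAlgebra 0ℓ 0ℓ
reduct A isBA = record { isBooleanAlgebra = isBA }

-- The carrier is assumed to be enumerated so that the ultrafilters can be
-- constructed without Zorn's lemma.
module Canonical (em : ∀ ℓ → ExcludedMiddle ℓ)
                 (A : Structure) (A-boolean : HasBooleanReduct A)
                 (enum : ℕ → Structure.Carrier A)
                 (enum-onto : ∀ x → ∃[ k ] enum k ≡ x) where
  open Classical em
  private
    𝔸 = reduct A A-boolean
    module 𝔸 = BooleanAlgebra 𝔸
  open BooleanAlgebra 𝔸 using (Carrier; _≈_; _∧_; _∨_; ⊤; ⊥) renaming (¬_ to ~_)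
  open BooleanOrder 𝔸
  open Ultrafilters em 𝔸

  -- Points of the Stone space: ultrafilters presented as homomorphisms to the two-element algebra.
  record Point : Set where
    field
      holds  : Carrier → Bool
      resp   : ∀ {x y} → x ≈ y → holds x ≡ holds y
      ∧-homo : ∀ x y → holds (x ∧ y) ≡ holds x && holds y
      ~-homo : ∀ x → holds (~ x) ≡ not (holds x)
      ⊤-homo : holds ⊤ ≡ true

    ∨-homo : ∀ x y → holds (x ∨ y) ≡ holds x || holds y
    ∨-homo x y = begin
      holds (x ∨ y)                          ≡⟨ resp (¬-involutive (x ∨ y)) ⟨
      holds (~ ~ (x ∨ y))                    ≡⟨ ~-homo _ ⟩
      not (holds (~ (x ∨ y)))                ≡⟨ ≡.cong not (resp (deMorgan₂ x y)) ⟩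
      not (holds (~ x ∧ ~ y))                ≡⟨ ≡.cong not (∧-homo _ _) ⟩
      not (holds (~ x) && holds (~ y))
        ≡⟨ ≡.cong₂ (λ a b → not (a && b)) (~-homo x) (~-homo y) ⟩
      not (not (holds x) && not (holds y))   ≡⟨ lemma (holds x) (holds y) ⟩
      holds x || holds y                     ∎
      where
      open ≡.≡-Reasoning
      lemma : ∀ a b → not (not a && not b) ≡ a || b
      lemma true  _     = refl
      lemma false true  = refl
      lemma false false = refl

    ⊥-homo : holds ⊥ ≡ false
    ⊥-homo = begin
      holds ⊥          ≡⟨ resp (BooleanAlgebraProperties.¬⊤≈⊥ 𝔸) ⟨
      holds (~ ⊤)      ≡⟨ ~-homo ⊤ ⟩
      not (holds ⊤)    ≡⟨ ≡.cong not ⊤-homo ⟩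
      false            ∎
      where open ≡.≡-Reasoning

    holds-up : ∀ {x y} → x ≤ y → holds x ≡ true → holds y ≡ true
    holds-up x≤y hx = &&-trueʳ (≡.trans (≡.sym (∧-homo _ _)) (≡.trans (≡.sym (resp x≤y)) hx))

    holds-⋀ : ∀ {xs} → All (λ x → holds x ≡ true) xs → holds (⋀ xs) ≡ true
    holds-⋀ []         = ⊤-homo
    holds-⋀ (hx ∷ hxs) = ≡.trans (∧-homo _ _) (&&-true hx (holds-⋀ hxs))

    holds-⋁ : ∀ xs → holds (⋁ xs) ≡ true → ∃[ x ] x ∈ˡ xs × holds x ≡ true
    holds-⋁ []       h with () ← ≡.trans (≡.sym ⊥-homo) h
    holds-⋁ (x ∷ xs) h with ||-true⁻ {holds x} (≡.trans (≡.sym (∨-homo x _)) h)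
    ... | inj₁ hx  = x , here refl , hx
    ... | inj₂ hxs = let y , y∈ , hy = holds-⋁ xs hxs in y , there y∈ , hy

  open Point

  _~_ : Rel Point 0ℓ
  p ~ q = ∀ x → holds p x ≡ holds q x

  ultrafilter⇒point : ∀ {u} {U : Pred Carrier u} → ProperFilter 𝔸 U →
                      (∀ x → x ∈ U ⊎ ~ x ∈ U) → Point
  ultrafilter⇒point {U = U} U-filter decides = record
    { holds  = λ x → ⌞ U x ⌟
    ; resp   = λ x≈y → ≡-from-⇔
        (λ h → ⌞⌟-complete (up (≤-reflexive x≈y) (⌞⌟-sound h)))
        (λ h → ⌞⌟-complete (up (≤-reflexive (𝔸.sym x≈y)) (⌞⌟-sound h)))
    ; ∧-homo = λ x y → ≡-from-⇔
        (λ h → &&-true (⌞⌟-complete (up (x∧y≤x x y) (⌞⌟-sound h)))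
                       (⌞⌟-complete (up (x∧y≤y x y) (⌞⌟-sound h))))
        (λ h → ⌞⌟-complete (∧-closed (⌞⌟-sound (&&-trueˡ h)) (⌞⌟-sound (&&-trueʳ {⌞ U x ⌟} h))))
    ; ~-homo = λ x → ≡-from-⇔
        (λ h → ≢true⇒not λ h′ → ⊥∉ (up (≤-reflexive (𝔸.∧-complementʳ x))
          (∧-closed (⌞⌟-sound h′) (⌞⌟-sound h))))
        (λ h → ⌞⌟-complete ([ (λ x∈U → ⊥-elim (not⇒≢true h (⌞⌟-complete x∈U))) , id ]′
          (decides x)))
    ; ⊤-homo = ⌞⌟-complete ⊤∈
    }
    where open ProperFilter U-filter

  -- The ultrafilter theorem for a countable algebra. It supplies the points that separate elements
  -- and those that prove compactness.
  finiteMeetProperty⇒point :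
    (G : Pred Carrier 0ℓ) → (∀ gs → All G gs → ¬ ⋀ gs ≤ ⊥) →
    ∃[ p ] (∀ g → g ∈ G → holds p g ≡ true)
  finiteMeetProperty⇒point G fmp =
    ultrafilter⇒point U-filter decides-all , λ g g∈G → ⌞⌟-complete (G⊆U g g∈G)
    where
    F : Pred Carrier 0ℓ
    F x = ∃[ gs ] All G gs × ⋀ gs ≤ x

    F-filter : ProperFilter 𝔸 F
    F-filter = record
      { up       = λ x≤y (gs , gs⊆ , ≤x) → gs , gs⊆ , ≤-trans ≤x x≤y
      ; ∧-closed = λ (gs , gs⊆ , ≤x) (hs , hs⊆ , ≤y) →
          gs ++ hs , All.++⁺ gs⊆ hs⊆ , ≤-trans (⋀-++ gs hs) (∧-mono ≤x ≤y)
      ; ⊤∈       = [] , [] , ≤-refl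
      ; ⊥∉       = λ (gs , gs⊆ , ≤⊥) → fmp gs gs⊆ ≤⊥
      }

    extension = ultrafilter-extension F-filter enum
    U         = proj₁ extension
    U-filter  = proj₁ (proj₂ extension)
    extends   = proj₁ (proj₂ (proj₂ extension))
    decides   = proj₂ (proj₂ (proj₂ extension))

    decides-all : ∀ x → x ∈ U ⊎ ~ x ∈ U
    decides-all x with enum-onto x
    ... | k , refl = decides k

    G⊆U : ∀ g → g ∈ G → g ∈ U
    G⊆U g g∈G with enum-onto g
    ... | k , refl = extends k (enum k ∷ [] , g∈G ∷ [] , x∧y≤x _ _)

  open Powerset em Point _~_ public renaming (order to orderˢ)
  open Poset orderˢ using () renaming (_≤_ to _≤ˢ_)

  e : Carrier → Subset
  e x = (λ p → holds p x) , λ p~q → p~q x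

  -- If `x ≤ y` fails, then `x` and `~ y` have the finite meet property, and a point containing both
  -- lies in `e x` but not in `e y`.
  e-reflects-≤ : ∀ {x y} → e x ≤ˢ e y → x ≤ y
  e-reflects-≤ {x} {y} ex≤ey = by-contradiction λ x≰y →
    let p , p∋ = finiteMeetProperty⇒point (λ g → g ≡ x ⊎ g ≡ ~ y)
          λ gs gs⊆ ⋀gs≤⊥ → x≰y (∧~≤⊥⇒≤ (≤-trans (below gs gs⊆) ⋀gs≤⊥))
    in not⇒≢true (≡.trans (≡.sym (~-homo p y)) (p∋ (~ y) (inj₂ refl)))
         (≤⇒∋ {e x} {e y} ex≤ey {p} (p∋ x (inj₁ refl)))
    where
    below : ∀ gs → All (λ g → g ≡ x ⊎ g ≡ ~ y) gs → x ∧ ~ y ≤ ⋀ gs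
    below []       []               = x≤⊤ _
    below (g ∷ gs) (inj₁ refl ∷ gs⊆) = ∧-greatest (x∧y≤x _ _) (below gs gs⊆)
    below (g ∷ gs) (inj₂ refl ∷ gs⊆) = ∧-greatest (x∧y≤y _ _) (below gs gs⊆)

  e-mono : ∀ {x y} → x ≤ y → e x ≤ˢ e y
  e-mono {x} {y} x≤y = ∋⇒≤ {e x} {e y} λ {p} → holds-up p x≤y

  e-injective : ∀ {x y} → (∀ p → holds p x ≡ holds p y) → x ≈ y
  e-injective {x} {y} eq = antisym
    (e-reflects-≤ {x} {y} (∋⇒≤ {e x} {e y} λ {p} h → ≡.trans (≡.sym (eq p)) h))
    (e-reflects-≤ {y} {x} (∋⇒≤ {e y} {e x} λ {p} h → ≡.trans (eq p) h))

  -- Distinct ultrafilters are incomparable: an inclusion of `q` in `p` would, by passing to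
  -- complements, give the reverse inclusion.
  distinguish : ∀ {p q} → ¬ p ~ q → ∃[ x ] holds p x ≡ false × holds q x ≡ true
  distinguish {p} {q} p≁q = by-contradiction λ ∄ →
    let backward : ∀ x → holds q x ≡ true → holds p x ≡ true
        backward x qx = by-contradiction λ p∌x → ∄ (x , Bool.¬-not p∌x , qx)
    in p≁q λ x → ≡-from-⇔
         (λ px → by-contradiction λ q∌x → not⇒≢true
           (≡.trans (≡.sym (~-homo p x))
             (backward (~ x) (≡.trans (~-homo q x) (≢true⇒not q∌x)))) px)
         (backward x)

  private
    Closed Open : Pred Subset _
    Closed = IsClosed (orderOf A A-boolean) orderˢ e
    Open   = IsOpen (orderOf A A-boolean) orderˢ e

  -- A closed element is specified only by being an infimum, so it is compared with the actual
  -- intersection of the clopen sets `e x` whose infimum it is.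
  closed∋ : ∀ {c p} → Closed c → (∀ x → c ≤ˢ e x → holds p x ≡ true) → c ∋ p
  closed∋ {c} {p} (S , _ , lower , greatest) p∋ =
    ≤⇒∋ {⋂S} {c} (greatest ⋂S (proj₁ (intersection-isInf _)))
      (⌞⌟-complete λ { d (x , x∈S , ex≈d) → ≡.trans (≡.sym (ex≈d p)) (p∋ x
        (∋⇒≤ {c} {e x} λ {q} c∋q → ≡.trans (ex≈d q)
          (≤⇒∋ {c} {d} (lower d (x , x∈S , ex≈d)) c∋q))) })
    where ⋂S = intersection (Image (orderOf A A-boolean) orderˢ e S)

  open∋ : ∀ {d p} → Open d → d ∋ p → ∃[ x ] e x ≤ˢ d × holds p x ≡ true
  open∋ {d} {p} (S , _ , upper , least) d∋p
    with ⌞⌟-sound (≤⇒∋ {d} {⋃S} (least ⋃S (proj₁ (union-isSup _))) d∋p)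
    where ⋃S = union (Image (orderOf A A-boolean) orderˢ e S)
  ... | T , (x , x∈S , ex≈T) , T∋p =
    x , (∋⇒≤ {e x} {d} λ {q} h → ≤⇒∋ {T} {d} (upper T (x , x∈S , ex≈T))
          (≡.trans (≡.sym (ex≈T q)) h))
      , ≡.trans (ex≈T p) T∋p

  singleton : Point → Subset
  singleton p = (λ q → ⌞ p ~ q ⌟) , λ q~r → ≡-from-⇔
    (λ h → ⌞⌟-complete λ x → ≡.trans (⌞⌟-sound h x) (q~r x))
    (λ h → ⌞⌟-complete λ x → ≡.trans (⌞⌟-sound h x) (≡.sym (q~r x)))

  cosingleton : Point → Subset
  cosingleton p = (λ q → not ⌞ p ~ q ⌟) , λ {q} {r} q~r →
    ≡.cong not (proj₂ (singleton p) {q} {r} q~r)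

  -- An ultrafilter is the only point that contains all of its members, so its singleton is the
  -- intersection of their images.
  singleton-closed : ∀ p {c} → (∀ q → proj₁ c q ≡ proj₁ (singleton p) q) → Closed c
  singleton-closed p {c} c≈ =
    (λ x → holds p x ≡ true) , (⊤ , ⊤-homo p) ,
    (λ { d (x , p∋x , ex≈d) → ∋⇒≤ {c} {d} λ {q} c∋q → ≡.trans (≡.sym (ex≈d q))
           (≡.trans (≡.sym (⌞⌟-sound (≡.trans (≡.sym (c≈ q)) c∋q) x)) p∋x) }) ,
    λ l l-lower → ∋⇒≤ {l} {c} λ {q} l∋q → ≡.trans (c≈ q) (⌞⌟-complete
      (by-contradiction λ p≁q → let x , px , qx = distinguish {q} {p} (λ q~p → p≁q (λ y → ≡.sym (q~p y))) in
        false≢true (≡.trans (≡.sym px)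
          (≤⇒∋ {l} {e x} (l-lower (e x) (x , qx , λ _ → refl)) l∋q))))

  cosingleton-open : ∀ p {d} → (∀ q → proj₁ d q ≡ proj₁ (cosingleton p) q) → Open d
  cosingleton-open p {d} d≈ =
    (λ x → holds p x ≡ false) , (⊥ , ⊥-homo p) ,
    (λ { c (x , p∌x , ex≈c) → ∋⇒≤ {c} {d} λ {q} c∋q → ≡.trans (d≈ q)
           (≢true⇒not λ h → false≢true (≡.trans (≡.sym p∌x) (≡.trans (⌞⌟-sound h x)
             (≡.trans (ex≈c q) c∋q)))) }) ,
    λ u u-upper → ∋⇒≤ {d} {u} λ {q} d∋q →
      let x , px , qx = distinguish {p} {q} (λ p~q →
            not⇒≢true (≡.trans (≡.sym (d≈ q)) d∋q) (⌞⌟-complete p~q))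
      in ≤⇒∋ {e x} {u} (u-upper (e x) (x , px , λ _ → refl)) qx

  private
    PA = orderOf A A-boolean

    preservesMeets : ∀ (xs : List Carrier) m →
                     IsInf PA (_∈ˡ xs) m → IsInf orderˢ (Image PA orderˢ e (_∈ˡ xs)) (e m)
    preservesMeets xs m (lower , greatest) =
      (λ { d (x , x∈ , ex≈d) → ∋⇒≤ {e m} {d} λ {p} h →
             ≡.trans (≡.sym (ex≈d p)) (holds-up p (lower x x∈) h) }) ,
      λ l l-lower → ∋⇒≤ {l} {e m} λ {p} l∋p →
        holds-up p (greatest (⋀ xs) (λ x → ⋀-≤)) (holds-⋀ p (All.tabulate λ {x} x∈ →
          ≤⇒∋ {l} {e x} (l-lower (e x) (x , x∈ , λ _ → refl)) l∋p))

    preservesJoins : ∀ (xs : List Carrier) m →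
                     IsSup PA (_∈ˡ xs) m → IsSup orderˢ (Image PA orderˢ e (_∈ˡ xs)) (e m)
    preservesJoins xs m (upper , least) =
      (λ { d (x , x∈ , ex≈d) → ∋⇒≤ {d} {e m} λ {p} h →
             holds-up p (upper x x∈) (≡.trans (ex≈d p) h) }) ,
      λ u u-upper → ∋⇒≤ {e m} {u} λ {p} h →
        let x , x∈ , hx = holds-⋁ p xs (holds-up p (least (⋁ xs) (λ x → ≤-⋁)) h)
        in ≤⇒∋ {e x} {u} (u-upper (e x) (x , x∈ , λ _ → refl)) hx

    joinDense : ∀ S → ∃[ 𝒮 ] 𝒮 ⊆ Closed × IsSup orderˢ {0ℓ} 𝒮 S
    joinDense S =
      (λ c → ∃[ p ] S ∋ p × (∀ q → proj₁ c q ≡ proj₁ (singleton p) q)) ,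
      (λ { {c} (p , _ , c≈) → singleton-closed p {c} c≈ }) ,
      (λ { c (p , S∋p , c≈) → ∋⇒≤ {c} {S} λ {q} c∋q →
             ≡.trans (≡.sym (proj₂ S (⌞⌟-sound (≡.trans (≡.sym (c≈ q)) c∋q)))) S∋p }) ,
      λ u u-upper → ∋⇒≤ {S} {u} λ {p} S∋p →
        ≤⇒∋ {singleton p} {u} (u-upper (singleton p) (p , S∋p , λ _ → refl))
          (⌞⌟-complete λ _ → refl)

    meetDense : ∀ S → ∃[ 𝒮 ] 𝒮 ⊆ Open × IsInf orderˢ {0ℓ} 𝒮 S
    meetDense S =
      (λ d → ∃[ p ] ¬ S ∋ p × (∀ q → proj₁ d q ≡ proj₁ (cosingleton p) q)) ,
      (λ { {d} (p , _ , d≈) → cosingleton-open p {d} d≈ }) ,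
      (λ { d (p , S∌p , d≈) → ∋⇒≤ {S} {d} λ {q} S∋q → ≡.trans (d≈ q)
             (≢true⇒not λ h → S∌p (≡.trans (proj₂ S (⌞⌟-sound h)) S∋q)) }) ,
      λ l l-lower → ∋⇒≤ {l} {S} λ {p} l∋p → by-contradiction λ S∌p →
        not⇒≢true
          (≤⇒∋ {l} {cosingleton p} (l-lower (cosingleton p) (p , S∌p , λ _ → refl)) l∋p)
          (⌞⌟-complete λ _ → refl)

    module _ {𝒜 ℬ : Pred Subset 0ℓ} where

      FiniteSubcover : Set
      FiniteSubcover = ∃[ 𝒜₀ ] ∃[ ℬ₀ ] (_∈ˡ toList 𝒜₀) ⊆ 𝒜 × (_∈ˡ toList ℬ₀) ⊆ ℬ ×
                       intersection (_∈ˡ toList 𝒜₀) ≤ˢ union (_∈ˡ toList ℬ₀)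

      -- Compactness is proved by contradiction: a point containing all of `G` would lie in every
      -- closed set of `𝒜` and outside every open set of `ℬ`.
      G : Pred Carrier 0ℓ
      G g = (∃[ c ] c ∈ 𝒜 × c ≤ˢ e g) ⊎ (∃[ d ] d ∈ ℬ × ∃[ x ] e x ≤ˢ d × g ≡ ~ x)

      -- Each member of `G` owes its presence to one set of `𝒜` or of `ℬ`, so a finite meet depends
      -- on finitely many of these sets.
      support : ∀ gs → All G gs →
        ∃[ 𝒜₀ ] ∃[ ℬ₀ ] All 𝒜 𝒜₀ × All ℬ ℬ₀ ×
        (∀ p → (∀ {c} → c ∈ˡ 𝒜₀ → c ∋ p) → (∀ {d} → d ∈ˡ ℬ₀ → ¬ d ∋ p) →
         holds p (⋀ gs) ≡ true)
      support [] [] = [] , [] , [] , [] , λ p _ _ → ⊤-homo p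
      support (g ∷ gs) (inj₁ (c , c∈ , c≤g) ∷ gs⊆) =
        let 𝒜₀ , ℬ₀ , as , bs , h = support gs gs⊆ in
        c ∷ 𝒜₀ , ℬ₀ , c∈ ∷ as , bs , λ p inA outB → ≡.trans (∧-homo p _ _) (&&-true
          (≤⇒∋ {c} {e g} c≤g (inA (here refl))) (h p (λ i → inA (there i)) outB))
      support (g ∷ gs) (inj₂ (d , d∈ , x , x≤d , refl) ∷ gs⊆) =
        let 𝒜₀ , ℬ₀ , as , bs , h = support gs gs⊆ in
        𝒜₀ , d ∷ ℬ₀ , as , d∈ ∷ bs , λ p inA outB → ≡.trans (∧-homo p _ _) (&&-true
          (≡.trans (~-homo p x) (≢true⇒not λ hx → outB (here refl) (≤⇒∋ {e x} {d} x≤d hx)))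
          (h p inA (λ i → outB (there i))))

      G-fmp : Satisfiable 𝒜 → Satisfiable ℬ → ¬ FiniteSubcover →
              ∀ gs → All G gs → ¬ ⋀ gs ≤ ⊥
      G-fmp (a , a∈) (b , b∈) none gs gs⊆ ⋀gs≤⊥ = none
        -- The lists from `support` may be empty; prefixing `a` and `b` makes them nonempty.
        ( (a ∷⁺ 𝒜₀) , (b ∷⁺ ℬ₀)
        , (λ {x} → All.lookup (a∈ ∷ as) {x}) , (λ {x} → All.lookup (b∈ ∷ bs) {x})
        , ∋⇒≤ {intersection (_∈ˡ toList (a ∷⁺ 𝒜₀))} {union (_∈ˡ toList (b ∷⁺ ℬ₀))}
            λ {p} inA → by-contradiction λ outB → false≢true (≡.trans (≡.sym (⊥-homo p))
              (holds-up p ⋀gs≤⊥ (h p (λ {c} i → ⌞⌟-sound inA c (there i))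
                (λ {d} i d∋p → outB (⌞⌟-complete (d , there i , d∋p)))))))
        where
        supp = support gs gs⊆
        𝒜₀ = proj₁ supp
        ℬ₀ = proj₁ (proj₂ supp)
        as = proj₁ (proj₂ (proj₂ supp))
        bs = proj₁ (proj₂ (proj₂ (proj₂ supp)))
        h  = proj₂ (proj₂ (proj₂ (proj₂ supp)))

      finiteSubcover : Satisfiable 𝒜 → Satisfiable ℬ → 𝒜 ⊆ Closed → ℬ ⊆ Open →
                       intersection 𝒜 ≤ˢ union ℬ → FiniteSubcover
      finiteSubcover a∈ b∈ closed open′ ≤∪ = by-contradiction λ none →
        let p , p∋ = finiteMeetProperty⇒point G (G-fmp a∈ b∈ none)
            d , d∈ , d∋p = ⌞⌟-sound (≤⇒∋ {intersection 𝒜} {union ℬ} ≤∪ {p}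
              (⌞⌟-complete λ c c∈ → closed∋ {c} {p} (closed {c} c∈) λ x c≤x →
                 p∋ x (inj₁ (c , c∈ , c≤x))))
            x , x≤d , px = open∋ {d} {p} (open′ {d} d∈) d∋p
        in not⇒≢true (≡.trans (≡.sym (~-homo p x))
             (p∋ (~ x) (inj₂ (d , d∈ , x , x≤d , refl)))) px

      subcover-suffices : FiniteSubcover → intersection 𝒜 ≤ˢ union ℬ
      subcover-suffices (𝒜₀ , ℬ₀ , 𝒜₀⊆ , ℬ₀⊆ , ≤₀) =
        ∋⇒≤ {intersection 𝒜} {union ℬ} λ {p} inA →
          let d , d∈ , d∋p = ⌞⌟-sound (≤⇒∋ {intersection (_∈ˡ toList 𝒜₀)} {union (_∈ˡ toList ℬ₀)} ≤₀
                {p} (⌞⌟-complete λ c c∈ → ⌞⌟-sound inA c (𝒜₀⊆ c∈)))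
          in ⌞⌟-complete (d , ℬ₀⊆ d∈ , d∋p)

  isCanonicalCompletion : IsCanonicalCompletion PA orderˢ e
  isCanonicalCompletion = record
    { isCompletion = record
      { isCompleteLattice = isCompleteLattice
      ; isOrderEmbedding  = record
        { isOrderHomomorphism = record
          { cong = λ x≈y p → resp p x≈y
          ; mono = λ {x} {y} → e-mono {x} {y}
          }
        ; injective = λ {x} {y} → e-injective {x} {y}
        ; cancel    = λ {x} {y} → e-reflects-≤ {x} {y}
        }
      ; preservesMeets = preservesMeets
      ; preservesJoins = preservesJoins
      }
    ; joinDense = joinDense
    ; meetDense = meetDense
    ; compact   = λ 𝒜 ℬ a b closed open′ →
        mk⇔ (finiteSubcover {𝒜} {ℬ} a b closed open′) (subcover-suffices {𝒜} {ℬ})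
    }

  -- The operation `□π`

  private
    -- The box `id` is a placeholder: `□π` is yet to be defined from the approximants, and these
    -- depend on the Boolean part of the structure alone.
    Approximants : Subset → Pred Subset (lsuc 0ℓ)
    Approximants = □π-Approximants A (withBox powerset id id) A-boolean
                     (BooleanAlgebra.isBooleanAlgebra powerset) e

    module 𝒫 = BooleanAlgebra powerset
    module 𝒫≤ = Poset orderˢ

    Approximants-resp : ∀ {S T} → S 𝒫.≈ T → Approximants S ⊆ Approximants T
    Approximants-resp {S} {T} S≈T (p , q , p-closed , q-open , p≤S , S≤q , j-sup) =
      p , q , p-closed , q-open ,
      𝒫≤.trans {p} {S} {T} p≤S (𝒫≤.reflexive {S} {T} S≈T) ,
      𝒫≤.trans {T} {S} {q} (𝒫≤.reflexive {T} {S} (𝒫.sym {S} {T} S≈T)) S≤q , j-sup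

    □π : Subset → Subset
    □π S = intersection (Approximants S)

    □π-cong : ∀ {S T} → S 𝒫.≈ T → □π S 𝒫.≈ □π T
    □π-cong {S} {T} S≈T p = ≡-from-⇔
      (λ h → ⌞⌟-complete λ j j∈ →
        ⌞⌟-sound h j (Approximants-resp {T} {S} (𝒫.sym {S} {T} S≈T) {j} j∈))
      (λ h → ⌞⌟-complete λ j j∈ → ⌞⌟-sound h j (Approximants-resp {S} {T} S≈T {j} j∈))

  Aσ : Structure
  Aσ = withBox powerset □π (λ {S} {T} → □π-cong {S} {T})

  canonicalExtension : CanonicalExtension A Aσ
  canonicalExtension = record
    { A-boolean             = A-boolean
    ; B-boolean             = BooleanAlgebra.isBooleanAlgebra powerset
    ; e                     = e
    ; isCanonicalCompletion = isCanonicalCompletion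
    ; □-isπ                 = λ S → intersection-isInf (Approximants S)
    }

  private
    e-closed : ∀ x → Closed (e x)
    e-closed x = (_≡ x) , (x , refl) ,
      (λ { d (_ , refl , ex≈d) → 𝒫≤.reflexive {e x} {d} ex≈d }) ,
      λ l l-lower → l-lower (e x) (x , refl , λ _ → refl)

    e-open : ∀ x → Open (e x)
    e-open x = (_≡ x) , (x , refl) ,
      (λ { d (_ , refl , ex≈d) → 𝒫≤.reflexive {d} {e x} (𝒫.sym {e x} {d} ex≈d) }) ,
      λ u u-upper → u-upper (e x) (x , refl , λ _ → refl)

  open Structure A using (□_; □-cong)

  -- The element `e x` is both closed and open. Taken as both bounds it gives an approximant to
  -- which only elements equivalent to `x` contribute; conversely `x` contributes to every
  -- approximant.
  e-□-homo : ∀ x p → holds p (□ x) ≡ proj₁ (□π (e x)) p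
  e-□-homo x p = ≡-from-⇔
    (λ h → ⌞⌟-complete λ { j (c , d , _ , _ , c≤x , x≤d , upper , _) →
      ≤⇒∋ {e (□ x)} {j} (upper (e (□ x)) (x , c≤x , x≤d , λ _ → refl)) h })
    (λ h → ⌞⌟-sound h (e (□ x)) (e x , e x , e-closed x , e-open x ,
      𝒫≤.refl {e x} , 𝒫≤.refl {e x} ,
      (λ { d (y , x≤y , y≤x , ey≈d) → 𝒫≤.reflexive {d} {e (□ x)} (𝒫.sym {e (□ x)} {d}
           (λ q → ≡.trans (resp q (□-cong (antisym (e-reflects-≤ {x} {y} x≤y)
             (e-reflects-≤ {y} {x} y≤x)))) (ey≈d q))) }) ,
      λ u u-upper → u-upper (e (□ x)) (x , 𝒫≤.refl {e x} , 𝒫≤.refl {e x} , λ _ → refl)))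

  e-embedding : IsEmbedding A Aσ e
  e-embedding = record
    { cong   = λ x≈y p → resp p x≈y
    ; ∧-homo = λ x y p → ∧-homo p x y
    ; ∨-homo = λ x y p → ∨-homo p x y
    ; ~-homo = λ x p → ~-homo p x
    ; □-homo = e-□-homo
    ; ⊤-homo = ⊤-homo
    ; ⊥-homo = ⊥-homo
    } , λ {x} {y} → e-injective {x} {y}

  module _ (s : ℕ → Carrier) (s≤□ : ∀ k → s (suc k) ≤ □ s k) (s-dec : ∀ k → s (suc k) ≤ s k) where

    limit : Subset
    limit = intersection (λ c → ∃[ k ] c ≡ e (s k))

    limit-lower : ∀ k → limit ≤ˢ e (s k)
    limit-lower k = proj₁ (intersection-isInf _) (e (s k)) (k , refl)

    limit-greatest : ∀ T → (∀ k → T ≤ˢ e (s k)) → T ≤ˢ limit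
    limit-greatest T T-lower =
      proj₂ (intersection-isInf _) T λ { _ (k , refl) → T-lower k }

    private
      s-anti : ∀ {j k} → j ≤ᴺ k → s k ≤ s j
      s-anti j≤k = go (ℕ.≤⇒≤′ j≤k)
        where
        go : ∀ {j k} → j ≤′ k → s k ≤ s j
        go ≤′-refl       = ≤-refl
        go (≤′-step j≤k) = ≤-trans (s-dec _) (go j≤k)

      -- Finitely many terms of a decreasing sequence lie above a single term, which turns a finite
      -- subfamily given by compactness into one index.
      least : ∀ cs → All (λ c → ∃[ k ] c ≡ e (s k)) cs →
              ∃[ n ] (∀ {c} → c ∈ˡ cs → e (s n) ≤ˢ c)
      least []       []                = 0 , λ ()
      least (c ∷ cs) ((k , refl) ∷ cs⊆) with least cs cs⊆
      ... | n , n-least = k ⊔ n , λ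
        { (here refl) → e-mono {s (k ⊔ n)} {s k} (s-anti (ℕ.m≤m⊔n k n))
        ; {c} (there i) → 𝒫≤.trans {e (s (k ⊔ n))} {e (s n)} {c}
            (e-mono {s (k ⊔ n)} {s n} (s-anti (ℕ.m≤n⊔m k n))) (n-least i)
        }

    -- By compactness an open element above the limit is above some s n,
    -- which then contributes □ (s n), above s (suc n), to the join.
    limit≤□ : limit ≤ˢ □π limit
    limit≤□ = ∋⇒≤ {limit} {□π limit} λ {p} x∋p → ⌞⌟-complete
      λ { j (c , d , _ , d-open , c≤x , x≤d , upper , _) →
        let 𝒜₀ , ℬ₀ , 𝒜₀⊆ , ℬ₀⊆ , ≤₀ = finiteSubcover {𝒜 = λ c → ∃[ k ] c ≡ e (s k)} {ℬ = _≡ d}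
              (e (s 0) , 0 , refl) (d , refl)
              (λ { (k , refl) → e-closed (s k) }) (λ { refl → d-open })
              (𝒫≤.trans {limit} {d} {union (_≡ d)} x≤d (proj₁ (union-isSup (_≡ d)) d refl))
            n , n-least = least (toList 𝒜₀) (All.tabulate 𝒜₀⊆)
            sn≤d : e (s n) ≤ˢ d
            sn≤d = ∋⇒≤ {e (s n)} {d} λ {q} h →
              let d′ , d′∈ , d′∋q = ⌞⌟-sound
                    (≤⇒∋ {intersection (_∈ˡ toList 𝒜₀)} {union (_∈ˡ toList ℬ₀)} ≤₀
                      (⌞⌟-complete λ c c∈ → ≤⇒∋ {e (s n)} {c} (n-least c∈) h))
              in ≡.subst (_∋ q) (ℬ₀⊆ d′∈) d′∋q
        in ≤⇒∋ {e (□ s n)} {j}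
             (upper (e (□ s n))
               ( s n
               , 𝒫≤.trans {c} {limit} {e (s n)} c≤x (limit-lower n)
               , sn≤d , λ _ → refl))
             (holds-up p (s≤□ n) (≤⇒∋ {limit} {e (s (suc n))} (limit-lower (suc n)) x∋p)) }

-- Terms, quotients and free algebras

module _ {X Y : Set} (σ : X → Term Y) where

  bind : Term X → Term Y
  bind (var x)  = σ x
  bind (s ∧ᵗ t) = bind s ∧ᵗ bind t
  bind (s ∨ᵗ t) = bind s ∨ᵗ bind t
  bind (~ᵗ t)   = ~ᵗ bind t
  bind (□ᵗ t)   = □ᵗ bind t
  bind ⊤ᵗ       = ⊤ᵗ
  bind ⊥ᵗ       = ⊥ᵗ

  module _ (A : Structure) (v : Y → Structure.Carrier A) where
    open Structure A

    ⟦bind⟧ : ∀ t → ⟦_⟧ A (bind t) v ≡ ⟦_⟧ A t (λ x → ⟦_⟧ A (σ x) v)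
    ⟦bind⟧ (var x)  = refl
    ⟦bind⟧ (s ∧ᵗ t) = ≡.cong₂ _∧_ (⟦bind⟧ s) (⟦bind⟧ t)
    ⟦bind⟧ (s ∨ᵗ t) = ≡.cong₂ _∨_ (⟦bind⟧ s) (⟦bind⟧ t)
    ⟦bind⟧ (~ᵗ t)   = ≡.cong ~_ (⟦bind⟧ t)
    ⟦bind⟧ (□ᵗ t)   = ≡.cong □_ (⟦bind⟧ t)
    ⟦bind⟧ ⊤ᵗ       = refl
    ⟦bind⟧ ⊥ᵗ       = refl

module _ (A : Structure) where
  open Structure A
  private module ≈ = IsEquivalence isEquivalence

  ⟦⟧-cong-on : ∀ {X} {Y : Pred X 0ℓ} {v w : X → Carrier} →
               (∀ {x} → x ∈ Y → v x ≈ w x) → ∀ t → VarsIn Y t → ⟦_⟧ A t v ≈ ⟦_⟧ A t w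
  ⟦⟧-cong-on v≈w (var x)  x∈      = v≈w x∈
  ⟦⟧-cong-on v≈w (s ∧ᵗ t) (i , j) = ∧-cong (⟦⟧-cong-on v≈w s i) (⟦⟧-cong-on v≈w t j)
  ⟦⟧-cong-on v≈w (s ∨ᵗ t) (i , j) = ∨-cong (⟦⟧-cong-on v≈w s i) (⟦⟧-cong-on v≈w t j)
  ⟦⟧-cong-on v≈w (~ᵗ t)   i       = ~-cong (⟦⟧-cong-on v≈w t i)
  ⟦⟧-cong-on v≈w (□ᵗ t)   i       = □-cong (⟦⟧-cong-on v≈w t i)
  ⟦⟧-cong-on v≈w ⊤ᵗ       _       = ≈.refl
  ⟦⟧-cong-on v≈w ⊥ᵗ       _       = ≈.refl

  ⟦⟧-cong : ∀ {X} {v w : X → Carrier} →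
            (∀ x → v x ≈ w x) → ∀ t → ⟦_⟧ A t v ≈ ⟦_⟧ A t w
  ⟦⟧-cong v≈w (var x)  = v≈w x
  ⟦⟧-cong v≈w (s ∧ᵗ t) = ∧-cong (⟦⟧-cong v≈w s) (⟦⟧-cong v≈w t)
  ⟦⟧-cong v≈w (s ∨ᵗ t) = ∨-cong (⟦⟧-cong v≈w s) (⟦⟧-cong v≈w t)
  ⟦⟧-cong v≈w (~ᵗ t)   = ~-cong (⟦⟧-cong v≈w t)
  ⟦⟧-cong v≈w (□ᵗ t)   = □-cong (⟦⟧-cong v≈w t)
  ⟦⟧-cong v≈w ⊤ᵗ       = ≈.refl
  ⟦⟧-cong v≈w ⊥ᵗ       = ≈.refl

⟦⊡^⟧-cong : ∀ (A : Structure) {X Y : Set} {v : X → Structure.Carrier A} {w : Y → Structure.Carrier A}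
            s t → ⟦_⟧ A s v ≡ ⟦_⟧ A t w → ∀ k → ⟦_⟧ A (⊡^ k s) v ≡ ⟦_⟧ A (⊡^ k t) w
⟦⊡^⟧-cong A s t eq zero    = eq
⟦⊡^⟧-cong A s t eq (suc k) = ≡.cong (λ a → (□ a) ∧ a) (⟦⊡^⟧-cong A s t eq k)
  where open Structure A

module _ {A B : Structure} where
  private
    module A = Structure A
    module B = Structure B
    module ≈ = IsEquivalence B.isEquivalence

  module _ {h : A.Carrier → B.Carrier} (h-hom : IsHomomorphism A B h) where
    open IsHomomorphism h-hom

    hom-⟦⟧ : ∀ {X} (v : X → A.Carrier) t → h (⟦_⟧ A t v) B.≈ ⟦_⟧ B t (h ∘ v)
    hom-⟦⟧ v (var x)  = ≈.refl
    hom-⟦⟧ v (s ∧ᵗ t) = ≈.trans (∧-homo _ _) (B.∧-cong (hom-⟦⟧ v s) (hom-⟦⟧ v t))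
    hom-⟦⟧ v (s ∨ᵗ t) = ≈.trans (∨-homo _ _) (B.∨-cong (hom-⟦⟧ v s) (hom-⟦⟧ v t))
    hom-⟦⟧ v (~ᵗ t)   = ≈.trans (~-homo _) (B.~-cong (hom-⟦⟧ v t))
    hom-⟦⟧ v (□ᵗ t)   = ≈.trans (□-homo _) (B.□-cong (hom-⟦⟧ v t))
    hom-⟦⟧ v ⊤ᵗ       = ⊤-homo
    hom-⟦⟧ v ⊥ᵗ       = ⊥-homo

    preserves : ∀ {X} {v : X → A.Carrier} s t → A , v ⊨ᵉ (s ≋ t) → B , (h ∘ v) ⊨ᵉ (s ≋ t)
    preserves {v = v} s t eq =
      ≈.trans (≈.sym (hom-⟦⟧ v s)) (≈.trans (cong eq) (hom-⟦⟧ v t))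

    Cg-least : ∀ {R} → (∀ {x y} → R x y → h x B.≈ h y) → ∀ {x y} → Cg A R x y → h x B.≈ h y
    Cg-least R⊆ (Cg.incl r)     = R⊆ r
    Cg-least R⊆ (Cg.refl eq)    = cong eq
    Cg-least R⊆ (Cg.sym p)      = ≈.sym (Cg-least R⊆ p)
    Cg-least R⊆ (Cg.trans p q)  = ≈.trans (Cg-least R⊆ p) (Cg-least R⊆ q)
    Cg-least R⊆ (Cg.∧-cong p q) = ≈.trans (∧-homo _ _)
      (≈.trans (B.∧-cong (Cg-least R⊆ p) (Cg-least R⊆ q)) (≈.sym (∧-homo _ _)))
    Cg-least R⊆ (Cg.∨-cong p q) = ≈.trans (∨-homo _ _)
      (≈.trans (B.∨-cong (Cg-least R⊆ p) (Cg-least R⊆ q)) (≈.sym (∨-homo _ _)))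
    Cg-least R⊆ (Cg.~-cong p)   =
      ≈.trans (~-homo _) (≈.trans (B.~-cong (Cg-least R⊆ p)) (≈.sym (~-homo _)))
    Cg-least R⊆ (Cg.□-cong p)   =
      ≈.trans (□-homo _) (≈.trans (B.□-cong (Cg-least R⊆ p)) (≈.sym (□-homo _)))

    quotient-hom : ∀ {R} → (∀ {x y} → R x y → h x B.≈ h y) → IsHomomorphism (A /Cg R) B h
    quotient-hom R⊆ = record
      { cong = Cg-least R⊆ ; ∧-homo = ∧-homo ; ∨-homo = ∨-homo ; ~-homo = ~-homo
      ; □-homo = □-homo ; ⊤-homo = ⊤-homo ; ⊥-homo = ⊥-homo }

  module _ {h : A.Carrier → B.Carrier} (h-embedding : IsEmbedding A B h) where
    private
      h-hom = proj₁ h-embedding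

    reflects : ∀ {X} {v : X → A.Carrier} s t → B , (h ∘ v) ⊨ᵉ (s ≋ t) → A , v ⊨ᵉ (s ≋ t)
    reflects {v = v} s t eq = proj₂ h-embedding
      (≈.trans (hom-⟦⟧ h-hom v s) (≈.trans eq (≈.sym (hom-⟦⟧ h-hom v t))))

id-hom : ∀ A → IsHomomorphism A A id
id-hom A = record
  { cong = id ; ∧-homo = λ _ _ → ≈.refl ; ∨-homo = λ _ _ → ≈.refl ; ~-homo = λ _ → ≈.refl
  ; □-homo = λ _ → ≈.refl ; ⊤-homo = ≈.refl ; ⊥-homo = ≈.refl }
  where module ≈ = IsEquivalence (Structure.isEquivalence A)

module _ {A B C : Structure}
         {g : Structure.Carrier A → Structure.Carrier B}
         {h : Structure.Carrier B → Structure.Carrier C} where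
  private
    module C = IsEquivalence (Structure.isEquivalence C)
    open IsHomomorphism

  ∘-hom : IsHomomorphism B C h → IsHomomorphism A B g → IsHomomorphism A C (h ∘ g)
  ∘-hom h-hom g-hom = record
    { cong   = cong h-hom ∘ cong g-hom
    ; ∧-homo = λ x y → C.trans (cong h-hom (∧-homo g-hom x y)) (∧-homo h-hom _ _)
    ; ∨-homo = λ x y → C.trans (cong h-hom (∨-homo g-hom x y)) (∨-homo h-hom _ _)
    ; ~-homo = λ x → C.trans (cong h-hom (~-homo g-hom x)) (~-homo h-hom _)
    ; □-homo = λ x → C.trans (cong h-hom (□-homo g-hom x)) (□-homo h-hom _)
    ; ⊤-homo = C.trans (cong h-hom (⊤-homo g-hom)) (⊤-homo h-hom)
    ; ⊥-homo = C.trans (cong h-hom (⊥-homo g-hom)) (⊥-homo h-hom)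
    }

  ∘-embedding : IsEmbedding B C h → IsEmbedding A B g → IsEmbedding A C (h ∘ g)
  ∘-embedding (h-hom , h-inj) (g-hom , g-inj) = ∘-hom h-hom g-hom , g-inj ∘ h-inj

module _ {A : Structure} {R : Rel (Structure.Carrier A) 0ℓ} where
  open Structure A

  ⟦⟧-quotient : ∀ {X} (v : X → Carrier) t → ⟦_⟧ (A /Cg R) t v ≡ ⟦_⟧ A t v
  ⟦⟧-quotient v (var x)  = refl
  ⟦⟧-quotient v (s ∧ᵗ t) = ≡.cong₂ _∧_ (⟦⟧-quotient v s) (⟦⟧-quotient v t)
  ⟦⟧-quotient v (s ∨ᵗ t) = ≡.cong₂ _∨_ (⟦⟧-quotient v s) (⟦⟧-quotient v t)
  ⟦⟧-quotient v (~ᵗ t)   = ≡.cong ~_ (⟦⟧-quotient v t)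
  ⟦⟧-quotient v (□ᵗ t)   = ≡.cong □_ (⟦⟧-quotient v t)
  ⟦⟧-quotient v ⊤ᵗ       = refl
  ⟦⟧-quotient v ⊥ᵗ       = refl

  projection-hom : IsHomomorphism A (A /Cg R) id
  projection-hom = record
    { cong = Cg.refl ; ∧-homo = λ _ _ → ≈.refl ; ∨-homo = λ _ _ → ≈.refl
    ; ~-homo = λ _ → ≈.refl ; □-homo = λ _ → ≈.refl ; ⊤-homo = ≈.refl ; ⊥-homo = ≈.refl }
    where module ≈ = IsEquivalence (Structure.isEquivalence (A /Cg R))

  quotient∈ : ∀ {V} → A ∈ᵛ V → (A /Cg R) ∈ᵛ V
  quotient∈ (modal , sat) = record
    { isBooleanAlgebra = record
      { isDistributiveLattice = record
        { isLattice = record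
          { isEquivalence = Structure.isEquivalence (A /Cg R)
          ; ∨-comm     = λ x y → Cg.refl (M.∨-comm x y)
          ; ∨-assoc    = λ x y z → Cg.refl (M.∨-assoc x y z)
          ; ∨-cong     = Cg.∨-cong
          ; ∧-comm     = λ x y → Cg.refl (M.∧-comm x y)
          ; ∧-assoc    = λ x y z → Cg.refl (M.∧-assoc x y z)
          ; ∧-cong     = Cg.∧-cong
          ; absorptive = (λ x y → Cg.refl (M.∨-absorbs-∧ x y))
                       , (λ x y → Cg.refl (M.∧-absorbs-∨ x y))
          }
        ; ∨-distrib-∧ = (λ x y z → Cg.refl (M.∨-distribˡ-∧ x y z))
                      , (λ x y z → Cg.refl (M.∨-distribʳ-∧ x y z))
        ; ∧-distrib-∨ = (λ x y z → Cg.refl (M.∧-distribˡ-∨ x y z))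
                      , (λ x y z → Cg.refl (M.∧-distribʳ-∨ x y z))
        }
      ; ∨-complement = (λ x → Cg.refl (M.∨-complementˡ x)) , (λ x → Cg.refl (M.∨-complementʳ x))
      ; ∧-complement = (λ x → Cg.refl (M.∧-complementˡ x)) , (λ x → Cg.refl (M.∧-complementʳ x))
      ; ¬-cong       = Cg.~-cong
      }
    ; □-⊤ = Cg.refl □-⊤
    ; □-∧ = λ x y → Cg.refl (□-∧ x y)
    } , λ { (s ≋ t) ε∈V v → ≡.subst₂ (Cg A R) (≡.sym (⟦⟧-quotient v s)) (≡.sym (⟦⟧-quotient v t))
                              (Cg.refl (sat (s ≋ t) ε∈V v)) }
    where
    open IsModalAlgebra modal
    module M = IsBooleanAlgebra isBooleanAlgebra

module FreeAlgebra (em : ∀ ℓ → ExcludedMiddle ℓ) (V : Variety) (X : Set) where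
  open Classical em

  -- Validity quantifies over all algebras of `V` and lives in `Set₁`; its truth value keeps the
  -- free algebra in `Set`. The record wrapper keeps `s` and `t` inferable.
  record Valid (s t : Term X) : Set where
    field
      isTrue : ⌞ V ⊨ᵛ (s ≋ t) ⌟ ≡ true

    sound : V ⊨ᵛ (s ≋ t)
    sound = ⌞⌟-sound isTrue

  open Valid

  law : ∀ {s t} → V ⊨ᵛ (s ≋ t) → Valid s t
  law p = record { isTrue = ⌞⌟-complete p }

  Free : Structure
  Free = record
    { Carrier = Term X
    ; _≈_     = Valid
    ; _∧_ = _∧ᵗ_ ; _∨_ = _∨ᵗ_ ; ~_ = ~ᵗ_ ; □_ = □ᵗ_ ; ⊤ = ⊤ᵗ ; ⊥ = ⊥ᵗ
    ; isEquivalence = record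
      { refl  = law λ A A∈V v → E.refl A
      ; sym   = λ p → law λ A A∈V v → E.sym A (sound p A A∈V v)
      ; trans = λ p q → law λ A A∈V v →
                  E.trans A (sound p A A∈V v) (sound q A A∈V v)
      }
    ; ∧-cong = λ p q → law λ A A∈V v →
        Structure.∧-cong A (sound p A A∈V v) (sound q A A∈V v)
    ; ∨-cong = λ p q → law λ A A∈V v →
        Structure.∨-cong A (sound p A A∈V v) (sound q A A∈V v)
    ; ~-cong = λ p → law λ A A∈V v → Structure.~-cong A (sound p A A∈V v)
    ; □-cong = λ p → law λ A A∈V v → Structure.□-cong A (sound p A A∈V v)
    }
    where module E A = IsEquivalence (Structure.isEquivalence A)

  ⟦⟧-Free : ∀ {Y} (σ : Y → Term X) t → ⟦_⟧ Free t σ ≡ bind σ t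
  ⟦⟧-Free σ (var x)  = refl
  ⟦⟧-Free σ (s ∧ᵗ t) = ≡.cong₂ _∧ᵗ_ (⟦⟧-Free σ s) (⟦⟧-Free σ t)
  ⟦⟧-Free σ (s ∨ᵗ t) = ≡.cong₂ _∨ᵗ_ (⟦⟧-Free σ s) (⟦⟧-Free σ t)
  ⟦⟧-Free σ (~ᵗ t)   = ≡.cong ~ᵗ_ (⟦⟧-Free σ t)
  ⟦⟧-Free σ (□ᵗ t)   = ≡.cong □ᵗ_ (⟦⟧-Free σ t)
  ⟦⟧-Free σ ⊤ᵗ       = refl
  ⟦⟧-Free σ ⊥ᵗ       = refl

  Free∈ : Free ∈ᵛ V
  Free∈ = record
    { isBooleanAlgebra = record
      { isDistributiveLattice = record
        { isLattice = record
          { isEquivalence = Structure.isEquivalence Free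
          ; ∨-comm     = λ x y → law λ A A∈V v → M.∨-comm A A∈V _ _
          ; ∨-assoc    = λ x y z → law λ A A∈V v → M.∨-assoc A A∈V _ _ _
          ; ∨-cong     = Structure.∨-cong Free
          ; ∧-comm     = λ x y → law λ A A∈V v → M.∧-comm A A∈V _ _
          ; ∧-assoc    = λ x y z → law λ A A∈V v → M.∧-assoc A A∈V _ _ _
          ; ∧-cong     = Structure.∧-cong Free
          ; absorptive = (λ x y → law λ A A∈V v → M.∨-absorbs-∧ A A∈V _ _)
                       , (λ x y → law λ A A∈V v → M.∧-absorbs-∨ A A∈V _ _)
          }
        ; ∨-distrib-∧ = (λ x y z → law λ A A∈V v → M.∨-distribˡ-∧ A A∈V _ _ _)
                      , (λ x y z → law λ A A∈V v → M.∨-distribʳ-∧ A A∈V _ _ _)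
        ; ∧-distrib-∨ = (λ x y z → law λ A A∈V v → M.∧-distribˡ-∨ A A∈V _ _ _)
                      , (λ x y z → law λ A A∈V v → M.∧-distribʳ-∨ A A∈V _ _ _)
        }
      ; ∨-complement = (λ x → law λ A A∈V v → M.∨-complementˡ A A∈V _)
                     , (λ x → law λ A A∈V v → M.∨-complementʳ A A∈V _)
      ; ∧-complement = (λ x → law λ A A∈V v → M.∧-complementˡ A A∈V _)
                     , (λ x → law λ A A∈V v → M.∧-complementʳ A A∈V _)
      ; ¬-cong       = Structure.~-cong Free
      }
    ; □-⊤ = law λ A A∈V v → IsModalAlgebra.□-⊤ (proj₁ A∈V)
    ; □-∧ = λ x y → law λ A A∈V v → IsModalAlgebra.□-∧ (proj₁ A∈V) _ _
    } , λ { (s ≋ t) ε∈V σ → ≡.subst₂ (Structure._≈_ Free) (≡.sym (⟦⟧-Free σ s)) (≡.sym (⟦⟧-Free σ t))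
          (law λ A A∈V v → ≡.subst₂ (Structure._≈_ A) (≡.sym (⟦bind⟧ σ A v s)) (≡.sym (⟦bind⟧ σ A v t))
            (proj₂ A∈V (s ≋ t) ε∈V _)) }
    where
    module M A (A∈V : A ∈ᵛ V) = IsBooleanAlgebra (IsModalAlgebra.isBooleanAlgebra (proj₁ A∈V))

  eval-hom : ∀ {A} → A ∈ᵛ V → (v : X → Structure.Carrier A) →
             IsHomomorphism Free A (λ t → ⟦_⟧ A t v)
  eval-hom {A} A∈V v = record
    { cong = λ p → sound p A A∈V v
    ; ∧-homo = λ _ _ → ≈.refl ; ∨-homo = λ _ _ → ≈.refl ; ~-homo = λ _ → ≈.refl
    ; □-homo = λ _ → ≈.refl ; ⊤-homo = ≈.refl ; ⊥-homo = ≈.refl }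
    where module ≈ = IsEquivalence (Structure.isEquivalence A)

  ⟦⟧-var : ∀ t → ⟦_⟧ Free t var ≡ t
  ⟦⟧-var (var x)  = refl
  ⟦⟧-var (s ∧ᵗ t) = ≡.cong₂ _∧ᵗ_ (⟦⟧-var s) (⟦⟧-var t)
  ⟦⟧-var (s ∨ᵗ t) = ≡.cong₂ _∨ᵗ_ (⟦⟧-var s) (⟦⟧-var t)
  ⟦⟧-var (~ᵗ t)   = ≡.cong ~ᵗ_ (⟦⟧-var t)
  ⟦⟧-var (□ᵗ t)   = ≡.cong □ᵗ_ (⟦⟧-var t)
  ⟦⟧-var ⊤ᵗ       = refl
  ⟦⟧-var ⊥ᵗ       = refl

  Free-isFree : IsFree V Free var
  Free-isFree = Free∈ , λ A A∈V v → let module ≈ = IsEquivalence (Structure.isEquivalence A) in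
    (λ t → ⟦_⟧ A t v) , eval-hom A∈V v , (λ _ → ≈.refl) , λ g g-hom g≈v t →
      ≈.trans (IsHomomorphism.cong g-hom (≡.subst (Structure._≈_ Free t) (≡.sym (⟦⟧-var t))
                 (IsEquivalence.refl (Structure.isEquivalence Free))))
        (≈.trans (hom-⟦⟧ g-hom var t) (⟦⟧-cong A g≈v t))

-- The algebras with y ≤ ⊡^k z

infix 5 _≼_
_≼_ : ∀ {X} → Term X → Term X → Equation X
s ≼ t = s ≋ s ∧ᵗ t

module _ {A : Structure} where

  Cg-mono : {R S : Rel (Structure.Carrier A) 0ℓ} →
            (∀ {x y} → R x y → S x y) → ∀ {x y} → Cg A R x y → Cg A S x y
  Cg-mono R⊆S = Cg-least projection-hom (λ r → Cg.incl (R⊆S r))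

  -- A derivation in `Cg` uses finitely many generating pairs, and these all occur at one stage of
  -- the increasing family `S`.
  Cg-compact : {R : Rel (Structure.Carrier A) 0ℓ} →
               (S : ℕ → Rel (Structure.Carrier A) 0ℓ) →
               (∀ {m n x y} → m ≤ᴺ n → S m x y → S n x y) →
               (∀ {x y} → R x y → ∃[ n ] S n x y) →
               ∀ {x y} → Cg A R x y → ∃[ n ] Cg A (S n) x y
  Cg-compact {R} S S-mono R⊆ = go
    where
    both : ∀ {x y u v} → ∃[ n ] Cg A (S n) x y → ∃[ n ] Cg A (S n) u v →
           ∃[ n ] Cg A (S n) x y × Cg A (S n) u v
    both (m , p) (n , q) =
      m ⊔ n , Cg-mono (S-mono (ℕ.m≤m⊔n m n)) p , Cg-mono (S-mono (ℕ.m≤n⊔m m n)) q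

    go : ∀ {x y} → Cg A R x y → ∃[ n ] Cg A (S n) x y
    go (Cg.incl r)     = let n , s = R⊆ r in n , Cg.incl s
    go (Cg.refl eq)    = 0 , Cg.refl eq
    go (Cg.sym p)      = let n , q = go p in n , Cg.sym q
    go (Cg.trans p q)  = let n , i , j = both (go p) (go q) in n , Cg.trans i j
    go (Cg.∧-cong p q) = let n , i , j = both (go p) (go q) in n , Cg.∧-cong i j
    go (Cg.∨-cong p q) = let n , i , j = both (go p) (go q) in n , Cg.∨-cong i j
    go (Cg.~-cong p)   = let n , q = go p in n , Cg.~-cong q
    go (Cg.□-cong p)   = let n , q = go p in n , Cg.□-cong q

module ModalOrder (A : Structure) (modal : IsModalAlgebra A) where
  open Structure A
  open IsModalAlgebra modal
  open BooleanOrder (reduct A isBooleanAlgebra) public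
  private module ≈ = IsEquivalence isEquivalence

  □-mono : ∀ {x y} → x ≤ y → □ x ≤ □ y
  □-mono x≤y = ≈.trans (□-cong x≤y) (□-∧ _ _)

  dot : ℕ → Carrier → Carrier
  dot zero    c = c
  dot (suc k) c = □ dot k c ∧ dot k c

  ⟦⊡^⟧ : ∀ {X} (v : X → Carrier) t k → ⟦_⟧ A (⊡^ k t) v ≡ dot k (⟦_⟧ A t v)
  ⟦⊡^⟧ v t zero    = refl
  ⟦⊡^⟧ v t (suc k) = ≡.cong (λ a → □ a ∧ a) (⟦⊡^⟧ v t k)

  dot-anti : ∀ {j k} c → j ≤ᴺ k → dot k c ≤ dot j c
  dot-anti {j} c j≤k = go (ℕ.≤⇒≤′ j≤k)
    where
    go : ∀ {k} → j ≤′ k → dot k c ≤ dot j c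
    go ≤′-refl       = ≤-refl
    go (≤′-step j≤k) = ≤-trans (x∧y≤y _ _) (go j≤k)

  -- By monotonicity of `⊡`: from `a ≤ ⊡^k c` follows `a ≈ ⊡ a ≤ ⊡^(k+1) c`.
  fixpoint≤dot : ∀ {a c} → a ≈ □ a ∧ a → a ≤ c → ∀ k → a ≤ dot k c
  fixpoint≤dot fix a≤c zero    = a≤c
  fixpoint≤dot fix a≤c (suc k) =
    let ih = fixpoint≤dot fix a≤c k in
    ≤-trans (≤-reflexive fix) (∧-mono (□-mono ih) ih)

Between : ∀ {X} (x y z : Term X) → List (Equation X)
Between x y z = (y ≼ x) ∷ (x ≼ z) ∷ (x ≋ ⊡ x) ∷ []

Between⊨ : ∀ {X} V (x y z : Term X) k → Between x y z ⊨[ V ] (y ≼ ⊡^ k z)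
Between⊨ V x y z k A (modal , _) v (y≤x ∷ x≤z ∷ fix ∷ []) =
  ≡.subst (⟦_⟧ A y v ≤_) (≡.sym (⟦⊡^⟧ v z k)) (≤-trans y≤x (fixpoint≤dot fix x≤z k))
  where open ModalOrder A modal

module Bounds (em : ∀ ℓ → ExcludedMiddle ℓ) (V : Variety) where
  open FreeAlgebra em V (Fin 2) public

  y z : Term (Fin 2)
  y = var zero
  z = var (suc zero)

  BoundedOn : Pred ℕ 0ℓ → Rel (Term (Fin 2)) 0ℓ
  BoundedOn K s t = ∃[ k ] k ∈ K × s ≡ y × t ≡ y ∧ᵗ ⊡^ k z

  -- All these algebras have the carrier `Term (Fin 2)` and differ only in their equality, so the
  -- projections between them are the identity function.
  P : ℕ → Structure
  P n = Free /Cg BoundedOn (_≤ᴺ n)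

  P∞ : Structure
  P∞ = Free /Cg BoundedOn (λ _ → Unit)

  P∈ : ∀ n → P n ∈ᵛ V
  P∈ n = quotient∈ Free∈

  P∞∈ : P∞ ∈ᵛ V
  P∞∈ = quotient∈ Free∈

  infix 4 _≈[_]_ _≈[∞]_
  _≈[_]_ : Term (Fin 2) → ℕ → Term (Fin 2) → Set
  s ≈[ n ] t = Structure._≈_ (P n) s t

  _≈[∞]_ : Term (Fin 2) → Term (Fin 2) → Set
  _≈[∞]_ = Structure._≈_ P∞

  later : ∀ {m n s t} → m ≤ᴺ n → s ≈[ m ] t → s ≈[ n ] t
  later m≤n = Cg-mono λ (k , k≤m , eqs) → k , ℕ.≤-trans k≤m m≤n , eqs

  P→P∞ : ∀ {n s t} → s ≈[ n ] t → s ≈[∞] t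
  P→P∞ = Cg-mono λ (k , _ , eqs) → k , tt , eqs

  -- `P∞` is the direct limit of the `P n`.
  P∞-compact : ∀ {s t} → s ≈[∞] t → ∃[ n ] s ≈[ n ] t
  P∞-compact = Cg-compact _
    (λ m≤n (k , k≤m , eqs) → k , ℕ.≤-trans k≤m m≤n , eqs)
    (λ (k , _ , eqs) → k , k , ℕ.≤-refl , eqs)

  module _ {X : Set} {v : X → Term (Fin 2)} (s t : Term X) where

    P-⊨ : ∀ {n} → ⟦_⟧ Free s v ≈[ n ] ⟦_⟧ Free t v → P n , v ⊨ᵉ (s ≋ t)
    P-⊨ {n} = ≡.subst₂ _≈[ n ]_ (≡.sym (⟦⟧-quotient v s)) (≡.sym (⟦⟧-quotient v t))

    P-⊨⁻ : ∀ {n} → P n , v ⊨ᵉ (s ≋ t) → ⟦_⟧ Free s v ≈[ n ] ⟦_⟧ Free t v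
    P-⊨⁻ {n} = ≡.subst₂ _≈[ n ]_ (⟦⟧-quotient v s) (⟦⟧-quotient v t)

    P∞-⊨ : ⟦_⟧ Free s v ≈[∞] ⟦_⟧ Free t v → P∞ , v ⊨ᵉ (s ≋ t)
    P∞-⊨ = ≡.subst₂ _≈[∞]_ (≡.sym (⟦⟧-quotient v s)) (≡.sym (⟦⟧-quotient v t))

    P∞-⊨⁻ : P∞ , v ⊨ᵉ (s ≋ t) → ⟦_⟧ Free s v ≈[∞] ⟦_⟧ Free t v
    P∞-⊨⁻ = ≡.subst₂ _≈[∞]_ (⟦⟧-quotient v s) (⟦⟧-quotient v t)

  P∞-bounds : ∀ k → y ≈[∞] y ∧ᵗ ⊡^ k z
  P∞-bounds k = Cg.incl (k , tt , refl , refl)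

  module _ {A : Structure} (A∈V : A ∈ᵛ V) (v : Fin 2 → Structure.Carrier A)
           (bounds : ∀ k → A , v ⊨ᵉ (y ≼ ⊡^ k z)) where

    P∞-eval : IsHomomorphism P∞ A (λ t → ⟦_⟧ A t v)
    P∞-eval = quotient-hom (eval-hom A∈V v) λ { (k , _ , refl , refl) → bounds k }

  collapse : ∀ n → y ≈[ n ] y ∧ᵗ ⊡^ (suc n) z → WeaklyTransitive V
  collapse n y≤ = n , λ A A∈V v → let open Algebra A A∈V v in
    ≡.subst₂ (Structure._≈_ A) (≡.sym (⟦⊡^⟧ v (var tt) (suc n))) (≡.sym (⟦⊡^⟧ v (var tt) n))
      (antisym (x∧y≤y _ _) (≡.subst (dot n (v tt) ≤_) (⟦⊡^⟧ w z (suc n)) (evaluated y≤)))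
    where
    module Algebra A (A∈V : A ∈ᵛ V) (v : Unit → Structure.Carrier A) where
      open ModalOrder A (proj₁ A∈V) public
      w : Fin 2 → Structure.Carrier A
      w zero    = dot n (v tt)
      w (suc _) = v tt
      -- The iterates of `⊡` decrease, so `w` satisfies the equations for all `k ≤ n` and evaluation
      -- at `w` factors through `P n`.
      evaluated : ∀ {s t} → s ≈[ n ] t → Structure._≈_ A (⟦_⟧ A s w) (⟦_⟧ A t w)
      evaluated = Cg-least (eval-hom A∈V w) λ { (k , k≤n , refl , refl) →
        ≡.subst (dot n (v tt) ≤_) (≡.sym (⟦⊡^⟧ w z k)) (dot-anti (v tt) k≤n) }

  -- Everything that the three refutations take from closure under canonical extensions.
  record FixpointExtension : Set₁ where
    field
      B           : Structure
      B∈V         : B ∈ᵛ V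
      embed       : Term (Fin 2) → Structure.Carrier B
      isEmbedding : IsEmbedding P∞ B embed
      x           : Structure.Carrier B
    open Structure B
    field
      y≤x   : embed y ≈ embed y ∧ x
      x≤z   : x ≈ x ∧ embed z
      x-fix : x ≈ □ x ∧ x

  fixpointExtension : ClosedUnderCanonicalExtensions V → FixpointExtension
  fixpointExtension closed = record
    { B           = Aσ
    ; B∈V         = closed P∞ Aσ P∞∈ canonicalExtension
    ; embed       = e
    ; isEmbedding = e-embedding
    ; x           = x
    ; y≤x         = limit-greatest s s≤□ s-dec (e y) λ k → e-mono {y} {s k} (P∞-bounds k)
    ; x≤z         = limit-lower s s≤□ s-dec 0
    -- `limit≤□` unfolds to `x ≈ x ∧ □ x`, the fixpoint equation up to commutativity.
    ; x-fix       = λ p → ≡.trans (limit≤□ s s≤□ s-dec p)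
                      (Bool.∧-comm (proj₁ x p) (proj₁ (Structure.□_ Aσ x) p))
    }
    where
    open Enumeration em
    enum = enumeration (termEncoding finEncoding) ⊤ᵗ
    open Canonical em P∞ (IsModalAlgebra.isBooleanAlgebra (proj₁ P∞∈)) (proj₁ enum) (proj₂ enum)
    open ModalOrder P∞ (proj₁ P∞∈)
    s : ℕ → Term (Fin 2)
    s k = ⊡^ k z
    s≤□ : ∀ k → s (suc k) ≤ (□ᵗ s k)
    s≤□ k = x∧y≤x _ _
    s-dec : ∀ k → s (suc k) ≤ s k
    s-dec k = x∧y≤y _ _
    x = limit s s≤□ s-dec

-- Interpolation and coherence

VarsIn-mono : ∀ {X} {Y Z : Pred X 0ℓ} → Y ⊆ Z → ∀ t → VarsIn Y t → VarsIn Z t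
VarsIn-mono Y⊆Z (var x)  i       = Y⊆Z i
VarsIn-mono Y⊆Z (s ∧ᵗ t) (i , j) = VarsIn-mono Y⊆Z s i , VarsIn-mono Y⊆Z t j
VarsIn-mono Y⊆Z (s ∨ᵗ t) (i , j) = VarsIn-mono Y⊆Z s i , VarsIn-mono Y⊆Z t j
VarsIn-mono Y⊆Z (~ᵗ t)   i       = VarsIn-mono Y⊆Z t i
VarsIn-mono Y⊆Z (□ᵗ t)   i       = VarsIn-mono Y⊆Z t i
VarsIn-mono Y⊆Z ⊤ᵗ       _       = tt
VarsIn-mono Y⊆Z ⊥ᵗ       _       = tt

VarsIn-⊡^ : ∀ {X} {Y : Pred X 0ℓ} k {t} → VarsIn Y t → VarsIn Y (⊡^ k t)
VarsIn-⊡^ zero    i = i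
VarsIn-⊡^ (suc k) i = VarsIn-⊡^ k i , VarsIn-⊡^ k i

module Failures (em : ∀ ℓ → ExcludedMiddle ℓ) (V : Variety)
                (extension : Bounds.FixpointExtension em V)
                (notWeaklyTransitive : ¬ WeaklyTransitive V) where
  open Bounds em V
  open FixpointExtension extension

  private
    module B = Structure B
    module B≈ = IsEquivalence B.isEquivalence

    Free-⊡^ : ∀ {X} (v : X → Term (Fin 2)) t k → ⟦_⟧ Free (⊡^ k t) v ≡ ⊡^ k (⟦_⟧ Free t v)
    Free-⊡^ v t zero    = refl
    Free-⊡^ v t (suc k) = ≡.cong ⊡_ (Free-⊡^ v t k)

    all-later : ∀ {A : Set} {Q : ℕ → Pred A 0ℓ} →
                (∀ {m n x} → m ≤ᴺ n → Q m x → Q n x) → ∀ xs → All (λ x → ∃[ n ] Q n x) xs →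
                ∃[ n ] All (Q n) xs
    all-later mono []       []             = 0 , []
    all-later mono (x ∷ xs) ((m , q) ∷ qs) with all-later mono xs qs
    ... | n , qs′ = m ⊔ n , mono (ℕ.m≤m⊔n m n) q ∷ All.map (mono (ℕ.m≤n⊔m m n)) qs′

  noInterpolation : ¬ RightUniformDeductiveInterpolation V
  noInterpolation interpolation = notWeaklyTransitive (collapse N (P-y≤ N N-Π))
    where
    xs ys : List ℕ
    xs = 0 ∷ []
    ys = 1 ∷ 2 ∷ []

    Γ : List (Equation ℕ)
    Γ = Between (var 0) (var 1) (var 2)

    interpolant = interpolation xs ys (λ { (here refl , here ()) ; (here refl , there (here ()))
                                         ; (here refl , there (there ())) ; (there () , _) })
      Γ ( (in₁ , in₁ , in₀)
        ∷ (in₀ , in₀ , in₂)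
        ∷ (in₀ , in₀ , in₀)
        ∷ [])
      where
      in₀ : 0 ∈ˡ xs ++ ys
      in₀ = here refl
      in₁ : 1 ∈ˡ xs ++ ys
      in₁ = there (here refl)
      in₂ : 2 ∈ˡ xs ++ ys
      in₂ = there (there (here refl))

    Π    = proj₁ interpolant
    Π⊆ys = proj₁ (proj₂ interpolant)

    interpolates : ∀ s t → VarsIn (_∈ˡ ys) s → VarsIn (_∈ˡ ys) t →
                   Γ ⊨[ V ] (s ≋ t) ⇔ Π ⊨[ V ] (s ≋ t)
    interpolates s t s∈ t∈ = proj₂ (proj₂ interpolant) (s ≋ t) (λ _ → Empty) (λ ())
      (VarsIn-mono inj₁ s s∈ , VarsIn-mono inj₁ t t∈)

    -- Only the variables 1 and 2 occur in `Π`, so the values elsewhere are arbitrary.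
    v : ℕ → Term (Fin 2)
    v 1 = y
    v _ = z

    w : ℕ → B.Carrier
    w 0 = x
    w n = embed (v n)

    w≈ : ∀ {n} → n ∈ˡ ys → w n B.≈ embed (v n)
    w≈ (here refl)         = B≈.refl
    w≈ (there (here refl)) = B≈.refl

    -- An equation of `Π` follows from `Π`, hence from `Γ`, hence holds in `B` with `x` as the value
    -- of variable 0; the embedding reflects it to `P∞`.
    P∞⊨Π : All (P∞ , v ⊨ᵉ_) Π
    P∞⊨Π = All.tabulate λ { {s ≋ t} π∈ →
      let s∈ , t∈ = All.lookup Π⊆ys π∈ in
      reflects isEmbedding s t (B≈.trans (B≈.sym (⟦⟧-cong-on B w≈ s s∈)) (B≈.trans
        (Equivalence.from (interpolates s t s∈ t∈) (λ A A∈V u sat → All.lookup sat π∈)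
          B B∈V w (y≤x ∷ x≤z ∷ x-fix ∷ []))
        (⟦⟧-cong-on B w≈ t t∈))) }

    finite = all-later {Q = λ n ε → P n , v ⊨ᵉ ε}
      (λ { {x = s ≋ t} m≤n p → P-⊨ s t (later m≤n (P-⊨⁻ s t p)) }) Π
      (All.map (λ { {s ≋ t} p → let n , q = P∞-compact (P∞-⊨⁻ s t p) in n , P-⊨ s t q }) P∞⊨Π)
    N   = proj₁ finite
    N-Π = proj₂ finite

    -- `Γ` implies every bound, so `Π` does too, and a `P n` that satisfies `Π` satisfies one bound
    -- too many.
    P-y≤ : ∀ n → All (P n , v ⊨ᵉ_) Π → y ≈[ n ] y ∧ᵗ ⊡^ (suc n) z
    P-y≤ n sat = ≡.subst (λ t → y ≈[ n ] y ∧ᵗ t) (Free-⊡^ v (var 2) (suc n))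
      (P-⊨⁻ (var 1) (var 1 ∧ᵗ ⊡^ (suc n) (var 2))
        (Equivalence.to (interpolates (var 1) (var 1 ∧ᵗ ⊡^ (suc n) (var 2)) in₁
           (in₁ , VarsIn-⊡^ (suc n) in₂))
          (Between⊨ V (var 0) (var 1) (var 2) (suc n)) (P n) (P∈ n) v sat))
      where
      in₁ : 1 ∈ˡ ys
      in₁ = here refl
      in₂ : 2 ∈ˡ ys
      in₂ = there (here refl)

  notCoherent : ¬ Coherent V
  notCoherent coherent = contradiction
    (coherent A A∈V (3 , F₃.Free , var , F₃.Free-isFree , Γ , id , (id-hom A , id) ,
      λ a → a , λ b≈a → b≈a) 2 g)
    where
    module F₃ = FreeAlgebra em V (Fin 3)

    pattern 0F = zero
    pattern 1F = suc zero
    pattern 2F = suc (suc zero)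

    Γ : List (Term (Fin 3) × Term (Fin 3))
    Γ = Between (var 0F) (var 1F) (var 2F)

    A : Structure
    A = F₃.Free /Cg (λ s t → (s , t) ∈ˡ Γ)

    A∈V : A ∈ᵛ V
    A∈V = quotient∈ F₃.Free∈

    module A = Structure A
    module A≈ = IsEquivalence A.isEquivalence

    g : Fin 2 → Term (Fin 3)
    g i = var (suc i)

    A⊨bounds : ∀ k → A , g ⊨ᵉ (y ≼ ⊡^ k z)
    A⊨bounds k = ≡.subst (λ t → Structure._≈_ A (var 1F) (var 1F ∧ᵗ t))
      (≡.trans (ModalOrder.⟦⊡^⟧ A (proj₁ A∈V) var (var 2F) k)
        (≡.sym (ModalOrder.⟦⊡^⟧ A (proj₁ A∈V) g z k)))
      (Between⊨ V (var 0F) (var 1F) (var 2F) k A A∈V var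
        (Cg.incl (here refl) ∷ Cg.incl (there (here refl)) ∷
         Cg.incl (there (there (here refl))) ∷ []))

    m-hom : IsHomomorphism P∞ A (λ t → ⟦_⟧ A t g)
    m-hom = P∞-eval A∈V g A⊨bounds

    A→B : IsHomomorphism A B (λ t → ⟦_⟧ B t _)
    A→B = quotient-hom (F₃.eval-hom B∈V w) λ
      { (here refl) → y≤x ; (there (here refl)) → x≤z ; (there (there (here refl))) → x-fix }
      where
      w : Fin 3 → B.Carrier
      w zero    = x
      w (suc i) = embed (var i)

    -- Followed by the map from `A` to `B`, evaluation at `g` becomes the embedding of `P∞` into
    -- `B`. Hence `P∞` is, up to isomorphism, the subalgebra of `A` generated by `y` and `z`.
    m-injective : ∀ {s t} → ⟦_⟧ A s g A.≈ ⟦_⟧ A t g → s ≈[∞] t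
    m-injective {s} {t} eq = ≡.subst₂ _≈[∞]_ (P∞-var s) (P∞-var t)
      (reflects isEmbedding s t (B≈.trans (B≈.sym (hom-⟦⟧ A→B g s))
        (B≈.trans (IsHomomorphism.cong A→B eq) (hom-⟦⟧ A→B g t))))
      where
      P∞-var : ∀ t → ⟦_⟧ P∞ t var ≡ t
      P∞-var t = ≡.trans (⟦⟧-quotient var t) (⟦⟧-var t)

    S : Structure
    S = Sub A g

    module S = Structure S

    inSub : ∀ t → Generated A g (⟦_⟧ A t g)
    inSub (var i)  = gen i
    inSub (s ∧ᵗ t) = Generated.∧-closed (inSub s) (inSub t)
    inSub (s ∨ᵗ t) = Generated.∨-closed (inSub s) (inSub t)
    inSub (~ᵗ t)   = Generated.~-closed (inSub t)
    inSub (□ᵗ t)   = Generated.□-closed (inSub t)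
    inSub ⊤ᵗ       = ⊤-closed
    inSub ⊥ᵗ       = ⊥-closed

    representative : ∀ {a} → Generated A g a → ∃[ t ] ⟦_⟧ A t g A.≈ a
    representative (gen i)                  = var i , A≈.refl
    representative (Generated.resp eq p)    = let t , q = representative p in t , A≈.trans q eq
    representative (Generated.∧-closed p q) =
      let s , i = representative p ; t , j = representative q in s ∧ᵗ t , A.∧-cong i j
    representative (Generated.∨-closed p q) =
      let s , i = representative p ; t , j = representative q in s ∨ᵗ t , A.∨-cong i j
    representative (Generated.~-closed p)   = let t , q = representative p in ~ᵗ t , A.~-cong q
    representative (Generated.□-closed p)   = let t , q = representative p in □ᵗ t , A.□-cong q
    representative ⊤-closed                 = ⊤ᵗ , A≈.refl
    representative ⊥-closed                 = ⊥ᵗ , A≈.refl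

    M : Term (Fin 2) → S.Carrier
    M t = ⟦_⟧ A t g , inSub t

    M-hom : IsHomomorphism P∞ S M
    M-hom = record
      { cong = IsHomomorphism.cong m-hom ; ∧-homo = λ _ _ → A≈.refl ; ∨-homo = λ _ _ → A≈.refl
      ; ~-homo = λ _ → A≈.refl ; □-homo = λ _ → A≈.refl ; ⊤-homo = A≈.refl ; ⊥-homo = A≈.refl }

    -- κ is a homomorphism into P 0, hence into every P n and P∞, on the same
    -- underlying function.  In P∞ it inverts M up to f, and this uses only
    -- finitely many equations, so it already does so in some P N.
    contradiction : ¬ FinitelyPresented V S
    contradiction (n , F , η , (F∈V , universal) , R , f , (f-hom , f-inj) , f-onto) =
      notWeaklyTransitive (collapse N
        (trans′ (sym′ κfy) (trans′ bound (∧-cong′ κfy (dots κfz (suc N))))))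
      where
      Rel-R : Rel (Structure.Carrier F) 0ℓ
      Rel-R a b = (a , b) ∈ˡ R

      Q : Structure
      Q = F /Cg Rel-R
      module Q = Structure Q
      module Q≈ = IsEquivalence Q.isEquivalence

      -- Terms in `y` and `z` that represent the generators of the supposed presentation; they
      -- determine `κ`.
      lift : ∀ i → ∃[ t ] f (M t) Q.≈ η i
      lift i = let (a , p) , fa≈ = f-onto (η i) ; t , t≈a = representative p in t , fa≈ t≈a

      κ-def = universal (P 0) (P∈ 0) (λ i → proj₁ (lift i))
      κ     = proj₁ κ-def
      κ-hom = proj₁ (proj₂ κ-def)
      κ-η   = proj₁ (proj₂ (proj₂ κ-def))

      κ-hom∞ : IsHomomorphism F P∞ κ
      κ-hom∞ = ∘-hom (quotient-hom projection-hom λ (k , _ , eqs) → Cg.incl (k , tt , eqs)) κ-hom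

      κ-homₙ : ∀ n → IsHomomorphism F (P n) κ
      κ-homₙ n = ∘-hom (quotient-hom projection-hom
        λ (k , k≤0 , eqs) → Cg.incl (k , ℕ.≤-trans k≤0 z≤n , eqs)) κ-hom

      -- Both sides are homomorphisms from the free algebra `F` to `Q` that agree on the generators.
      fMκ : ∀ c → f (M (κ c)) Q.≈ c
      fMκ c = Q≈.trans
        (unique _ (∘-hom f-hom (∘-hom M-hom κ-hom∞))
          (λ i → Q≈.trans (IsHomomorphism.cong f-hom (IsHomomorphism.cong M-hom (P→P∞ (κ-η i))))
                   (proj₂ (lift i))) c)
        (Q≈.sym (unique id projection-hom (λ _ → Q≈.refl) c))
        where
        unique = proj₂ (proj₂ (proj₂ (universal Q (quotient∈ F∈V) η)))

      -- The relations hold in `P∞` after `κ`, because `f` and `M` are injective and `f ∘ M ∘ κ` is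
      -- the identity on `Q`. As `R` is finite, they will all hold at one finite stage.
      κ-R : All (λ (a , b) → ∃[ n ] κ a ≈[ n ] κ b) R
      κ-R = All.tabulate λ { {a , b} r → P∞-compact (m-injective (f-inj
        (Q≈.trans (fMκ a) (Q≈.trans (Cg.incl r) (Q≈.sym (fMκ b)))))) }

      κf : ∀ t → κ (f (M t)) ≈[∞] t
      κf t = m-injective (f-inj (fMκ (f (M t))))

      finite = all-later {Q = λ n (s , t) → s ≈[ n ] t} later
        ((κ (f (M y)) , y) ∷ (κ (f (M z)) , z) ∷ [])
        (P∞-compact (κf y) ∷ P∞-compact (κf z) ∷ [])
      finite-R = all-later {Q = λ n (a , b) → κ a ≈[ n ] κ b} later R κ-R

      N = proj₁ finite ⊔ proj₁ finite-R

      open Structure (P N) using () renaming (∧-cong to ∧-cong′; □-cong to □-cong′)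
      open IsEquivalence (Structure.isEquivalence (P N)) using ()
        renaming (refl to refl′; sym to sym′; trans to trans′)

      κfy : κ (f (M y)) ≈[ N ] y
      κfy = later (ℕ.m≤m⊔n _ (proj₁ finite-R)) (All.lookup (proj₂ finite) (here refl))

      κfz : κ (f (M z)) ≈[ N ] z
      κfz = later (ℕ.m≤m⊔n _ (proj₁ finite-R)) (All.lookup (proj₂ finite) (there (here refl)))

      κ-homᴺ : IsHomomorphism Q (P N) κ
      κ-homᴺ = quotient-hom (κ-homₙ N) λ r →
        later (ℕ.m≤n⊔m (proj₁ finite) _) (All.lookup (proj₂ finite-R) r)

      -- This homomorphism fixes `y` and `z`, so it carries every bound of `P∞` into `P N`,
      -- including the one for `suc N`.
      κfM-hom : IsHomomorphism P∞ (P N) (κ ∘ f ∘ M)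
      κfM-hom = ∘-hom κ-homᴺ (∘-hom f-hom M-hom)

      dots : ∀ {s t} → s ≈[ N ] t → ∀ k → ⊡^ k s ≈[ N ] ⊡^ k t
      dots p zero    = p
      dots p (suc k) = ∧-cong′ (□-cong′ (dots p k)) (dots p k)

      homo-⊡^ : ∀ t k → κ (f (M (⊡^ k t))) ≈[ N ] ⊡^ k (κ (f (M t)))
      homo-⊡^ t zero    = refl′
      homo-⊡^ t (suc k) = trans′ (∧-homo _ _) (∧-cong′ (trans′ (□-homo _) (□-cong′ ih)) ih)
        where
        open IsHomomorphism κfM-hom
        ih = homo-⊡^ t k

      bound : κ (f (M y)) ≈[ N ] κ (f (M y)) ∧ᵗ ⊡^ (suc N) (κ (f (M z)))
      bound = trans′ (cong (P∞-bounds (suc N)))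
        (trans′ (∧-homo _ _) (∧-cong′ refl′
          (homo-⊡^ z (suc N))))
        where open IsHomomorphism κfM-hom

-- Limits of sequences of structures and model completions

module _ (A : Structure) where
  open Structure A
  private module ≈ = IsEquivalence isEquivalence

  ∷ᵉ-cong : ∀ {n a} {ρ ρ′ : Fin n → Carrier} →
            (∀ j → ρ j ≈ ρ′ j) → ∀ j → (a ∷ᵉ ρ) j ≈ (a ∷ᵉ ρ′) j
  ∷ᵉ-cong ρ≈ zero    = ≈.refl
  ∷ᵉ-cong ρ≈ (suc j) = ρ≈ j

  Sat-cong : ∀ {C n} {c : C → Carrier} {ρ ρ′ : Fin n → Carrier} → (∀ j → ρ j ≈ ρ′ j) →
             ∀ φ → Sat A c ρ φ → Sat A c ρ′ φ
  Sat-cong {C} {c = c} {ρ} {ρ′} ρ≈ (s ≐ t) eq =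
    ≈.trans (≈.sym (⟦⟧-cong A env≈ s)) (≈.trans eq (⟦⟧-cong A env≈ t))
    where
    env≈ : ∀ x → [ c , ρ ]′ x ≈ [ c , ρ′ ]′ x
    env≈ (inj₁ k) = ≈.refl
    env≈ (inj₂ j) = ρ≈ j
  Sat-cong ρ≈ (φ ⇒ ψ) imp p =
    Sat-cong ρ≈ ψ (imp (Sat-cong (λ j → ≈.sym (ρ≈ j)) φ p))
  Sat-cong ρ≈ (∀ᶠ φ) all a = Sat-cong (∷ᵉ-cong ρ≈) φ (all a)

  module _ {C D : Set} {f : C → D} {c : C → Carrier} {d : D → Carrier}
           (d∘f≈c : ∀ k → d (f k) ≈ c k) where

    ⟦renameᵗ⟧ : ∀ {n} (ρ : Fin n → Carrier) t →
                ⟦_⟧ A (renameᵗ f t) [ d , ρ ]′ ≈ ⟦_⟧ A t [ c , ρ ]′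
    ⟦renameᵗ⟧ ρ (var (inj₁ k)) = d∘f≈c k
    ⟦renameᵗ⟧ ρ (var (inj₂ j)) = ≈.refl
    ⟦renameᵗ⟧ ρ (s ∧ᵗ t) = ∧-cong (⟦renameᵗ⟧ ρ s) (⟦renameᵗ⟧ ρ t)
    ⟦renameᵗ⟧ ρ (s ∨ᵗ t) = ∨-cong (⟦renameᵗ⟧ ρ s) (⟦renameᵗ⟧ ρ t)
    ⟦renameᵗ⟧ ρ (~ᵗ t)   = ~-cong (⟦renameᵗ⟧ ρ t)
    ⟦renameᵗ⟧ ρ (□ᵗ t)   = □-cong (⟦renameᵗ⟧ ρ t)
    ⟦renameᵗ⟧ ρ ⊤ᵗ       = ≈.refl
    ⟦renameᵗ⟧ ρ ⊥ᵗ       = ≈.refl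

    Sat-rename : ∀ {n} (ρ : Fin n → Carrier) φ → Sat A c ρ φ ⇔ Sat A d ρ (rename f φ)
    Sat-rename ρ (s ≐ t) = mk⇔
      (λ eq → ≈.trans (⟦renameᵗ⟧ ρ s) (≈.trans eq (≈.sym (⟦renameᵗ⟧ ρ t))))
      (λ eq → ≈.trans (≈.sym (⟦renameᵗ⟧ ρ s)) (≈.trans eq (⟦renameᵗ⟧ ρ t)))
    Sat-rename ρ ⊥ᶠ      = mk⇔ id id
    Sat-rename ρ (φ ⇒ ψ) = mk⇔
      (λ imp p → Equivalence.to (Sat-rename ρ ψ) (imp (Equivalence.from (Sat-rename ρ φ) p)))
      (λ imp p → Equivalence.from (Sat-rename ρ ψ) (imp (Equivalence.to (Sat-rename ρ φ) p)))
    Sat-rename ρ (∀ᶠ φ)  = mk⇔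
      (λ all a → Equivalence.to (Sat-rename (a ∷ᵉ ρ) φ) (all a))
      (λ all a → Equivalence.from (Sat-rename (a ∷ᵉ ρ) φ) (all a))

module _ {M N : Structure} {h : Structure.Carrier M → Structure.Carrier N}
         (h-embedding : IsEmbedding M N h) where
  private
    module N = Structure N
    module ≈ = IsEquivalence N.isEquivalence

  quantifierFree-⇔ : ∀ ρ ρ′ (φ : Sentence (Structure.Carrier M)) → QuantifierFree φ →
                     Sat M id ρ φ ⇔ Sat N h ρ′ φ
  quantifierFree-⇔ ρ ρ′ (s ≐ t) _ = mk⇔
    (λ eq → ≈.trans (≈.sym (env s)) (≈.trans (preserves (proj₁ h-embedding) s t eq) (env t)))
    (λ eq → reflects h-embedding s t (≈.trans (env s) (≈.trans eq (≈.sym (env t)))))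
    where
    env : ∀ t → ⟦_⟧ N t (h ∘ [ id , ρ ]′) N.≈ ⟦_⟧ N t [ h , ρ′ ]′
    env = ⟦⟧-cong N λ { (inj₁ _) → ≈.refl ; (inj₂ ()) }
  quantifierFree-⇔ ρ ρ′ ⊥ᶠ      _         = mk⇔ id id
  quantifierFree-⇔ ρ ρ′ (φ ⇒ ψ) (qφ , qψ) = mk⇔
    (λ imp p → to ψ⇔ (imp (from φ⇔ p)))
    (λ imp p → from ψ⇔ (imp (to φ⇔ p)))
    where
    open Equivalence
    φ⇔ = quantifierFree-⇔ ρ ρ′ φ qφ
    ψ⇔ = quantifierFree-⇔ ρ ρ′ ψ qψ

-- An ultraproduct of the N i restricted to the countably many sequences that
-- are definable by Skolem functions, so that the ultrafilter only has to
-- decide countably many subsets of ℕ.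
module SkolemLimit (em : ∀ ℓ → ExcludedMiddle ℓ) {C : Set} (E : Encoding C)
                   (N : ℕ → Structure) (c : ∀ i → C → Structure.Carrier (N i)) where
  open Classical em
  private
    module N i = Structure (N i)
    module N≈ i = IsEquivalence (N.isEquivalence i)

  -- One kind of symbol serves for all Skolem functions: `witness φ ss` stands for a value of the
  -- newest variable that makes `φ` true, if there is one, the other variables having the values of
  -- `ss`.
  data Skolem : Set where
    witness : ∀ {n} → Formula C (suc n) → Vec Skolem n → Skolem

  encodeSkolem  : Skolem → Tree
  encodeSkolems : ∀ {n} → Vec Skolem n → Tree
  encodeSkolem (witness {n} φ ss) = node (encodeℕ n) (node (encodeFormula E φ) (encodeSkolems ss))
  encodeSkolems []       = leaf
  encodeSkolems (s ∷ ss) = node (encodeSkolem s) (encodeSkolems ss)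

  decodeSkolem  : Tree → Maybe Skolem
  decodeSkolems : ∀ n → Tree → Maybe (Vec Skolem n)
  decodeSkolem (node k (node f t)) =
    Maybe.zipWith witness (decodeFormula E (suc (decodeℕ k)) f) (decodeSkolems (decodeℕ k) t)
  decodeSkolem _ = nothing
  decodeSkolems zero    _          = just []
  decodeSkolems (suc n) leaf       = nothing
  decodeSkolems (suc n) (node s t) = Maybe.zipWith _∷_ (decodeSkolem s) (decodeSkolems n t)

  inverseSkolem  : ∀ s → decodeSkolem (encodeSkolem s) ≡ just s
  inverseSkolems : ∀ {n} (ss : Vec Skolem n) → decodeSkolems n (encodeSkolems ss) ≡ just ss
  inverseSkolem (witness {n} φ ss)
    rewrite decodeℕ-encodeℕ n | inverse (formulaEncoding E) φ | inverseSkolems ss = refl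
  inverseSkolems []       = refl
  inverseSkolems (s ∷ ss) rewrite inverseSkolem s | inverseSkolems ss = refl

  -- The index set of the truth sets that the ultrafilter has to decide. Parameters form a `Vec`
  -- rather than a function so that they can be encoded.
  Instance : Set
  Instance = Σ ℕ λ n → Formula C n × Vec Skolem n

  instanceEncoding : Encoding Instance
  instanceEncoding = record
    { encode  = λ (n , φ , ss) → node (encodeℕ n) (node (encodeFormula E φ) (encodeSkolems ss))
    ; decode  = dec
    ; inverse = inv
    }
    where
    dec : Tree → Maybe Instance
    dec (node k (node f t)) = Maybe.zipWith (λ φ ss → decodeℕ k , φ , ss)
      (decodeFormula E (decodeℕ k) f) (decodeSkolems (decodeℕ k) t)
    dec _ = nothing
    inv : ∀ q → dec (node (encodeℕ (proj₁ q)) (node (encodeFormula E (proj₁ (proj₂ q)))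
                  (encodeSkolems (proj₂ (proj₂ q))))) ≡ just q
    inv (n , φ , ss)
      rewrite decodeℕ-encodeℕ n | inverse (formulaEncoding E) φ | inverseSkolems ss = refl

  choose : ∀ i {n} → Formula C (suc n) → (Fin n → N.Carrier i) → N.Carrier i
  choose i φ ρ with em _ {∃[ a ] Sat (N i) (c i) (a ∷ᵉ ρ) φ}
  ... | yes (a , _) = a
  -- An arbitrary default where `φ` has no witness.
  ... | no _        = N.⊤ i

  choose-sat : ∀ i {n} (φ : Formula C (suc n)) (ρ : Fin n → N.Carrier i) {a} →
               Sat (N i) (c i) (a ∷ᵉ ρ) φ → Sat (N i) (c i) (choose i φ ρ ∷ᵉ ρ) φ
  choose-sat i φ ρ {a} sat with em _ {∃[ a ] Sat (N i) (c i) (a ∷ᵉ ρ) φ}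
  ... | yes (_ , sat′) = sat′
  ... | no ∄           = ⊥-elim (∄ (a , sat))

  value  : ∀ i → Skolem → N.Carrier i
  values : ∀ i {n} → Vec Skolem n → Fin n → N.Carrier i
  value i (witness φ ss) = choose i φ (values i ss)
  values i []       = λ ()
  values i (s ∷ ss) = value i s ∷ᵉ values i ss

  values-tabulate : ∀ i {n} (ρ : Fin n → Skolem) j → values i (tabulate ρ) j ≡ value i (ρ j)
  values-tabulate i ρ zero    = refl
  values-tabulate i ρ (suc j) = values-tabulate i (ρ ∘ suc) j

  Holds : ∀ {n} → Formula C n → (Fin n → Skolem) → ℕ → Set
  Holds φ ρ i = Sat (N i) (c i) (λ j → value i (ρ j)) φ

  Holdsᵛ : Instance → ℕ → Set
  Holdsᵛ (n , φ , ss) i = Sat (N i) (c i) (values i ss) φ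

  Holdsᵛ⇔Holds : ∀ {n} (φ : Formula C n) ρ i → Holdsᵛ (n , φ , tabulate ρ) i ⇔ Holds φ ρ i
  Holdsᵛ⇔Holds φ ρ i = mk⇔
    (Sat-cong (N i) (λ j → N≈.reflexive i (values-tabulate i ρ j)) φ)
    (Sat-cong (N i) (λ j → N≈.reflexive i (≡.sym (values-tabulate i ρ j))) φ)

  private
    open Powerset em ℕ _≡_
    open BooleanAlgebra powerset using (_∧_)

    ⟅_⟆ : (ℕ → Set) → Subset
    ⟅ X ⟆ = (λ i → ⌞ X i ⌟) , ≡.cong (λ i → ⌞ X i ⌟)

    -- Starting from the Fréchet filter makes every sentence that holds in almost all `N i` hold in
    -- the limit.
    Cofinite : Pred Subset 0ℓ
    Cofinite T = ∃[ m ] (∀ i → m ≤ᴺ i → T ∋ i)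

    cofinite-filter : ProperFilter powerset Cofinite
    cofinite-filter = record
      { up       = λ {S} {T} S≤T (m , h) → m , λ i m≤i → ≤⇒∋ {S} {T} S≤T (h i m≤i)
      ; ∧-closed = λ (m , h) (n , k) → m ⊔ n , λ i ≤i → &&-true
          (h i (ℕ.≤-trans (ℕ.m≤m⊔n m n) ≤i)) (k i (ℕ.≤-trans (ℕ.m≤n⊔m m n) ≤i))
      ; ⊤∈       = 0 , λ _ _ → refl
      ; ⊥∉       = λ (m , h) → false≢true (h m ℕ.≤-refl)
      }

    instances = Enumeration.enumeration em instanceEncoding (0 , ⊥ᶠ , [])

    decided : ℕ → Subset
    decided k = ⟅ Holdsᵛ (proj₁ instances k) ⟆

    extension = Ultrafilters.ultrafilter-extension em powerset cofinite-filter decided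
    U-filter  = proj₁ (proj₂ extension)
    open ProperFilter U-filter

  -- The ultrafilter consists of `Bool`-valued sets; a predicate is large if it contains one of
  -- them.
  record U (X : ℕ → Set) : Set where
    constructor large
    field
      {set} : Subset
      set∈  : set ∈ proj₁ extension
      on    : ∀ {i} → set ∋ i → X i

  private
    U-map : ∀ {X Y} → (∀ i → X i → Y i) → U X → U Y
    U-map f (large {T} T∈ h) = large {set = T} T∈ λ {i} t → f i (h t)

    U-map₂ : ∀ {X Y Z} → (∀ i → X i → Y i → Z i) → U X → U Y → U Z
    U-map₂ f (large {S} S∈ g) (large {T} T∈ h) =
      large {set = S ∧ T} (∧-closed {S} {T} S∈ T∈) λ {i} st → f i (g (&&-trueˡ st)) (h (&&-trueʳ {proj₁ S i} st))

    U-always : ∀ {X} → (∀ i → X i) → U X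
    U-always f = large {set = BooleanAlgebra.⊤ powerset} ⊤∈ λ {i} _ → f i

    U-nonempty : ¬ U (λ _ → Empty)
    U-nonempty (large {T} T∈ h) = ⊥∉ (up {T} {BooleanAlgebra.⊥ powerset} (∋⇒≤ {T} {BooleanAlgebra.⊥ powerset}
      λ t → ⊥-elim (h t)) T∈)

    U-decides : ∀ {n} (φ : Formula C n) ρ → U (Holds φ ρ) ⊎ U (λ i → ¬ Holds φ ρ i)
    U-decides {n} φ ρ with proj₂ instances (n , φ , tabulate ρ)
    ... | k , eq with proj₂ (proj₂ (proj₂ extension)) k
    ... | inj₁ T∈ = inj₁ (large {set = decided k} T∈ λ {i} t → Equivalence.to (Holdsᵛ⇔Holds φ ρ i)
                      (≡.subst (λ q → Holdsᵛ q i) eq (⌞⌟-sound t)))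
    ... | inj₂ T∈ = inj₂ (large {set = BooleanAlgebra.¬_ powerset (decided k)} T∈ λ {i} t h → not⇒≢true t (⌞⌟-complete
                      (≡.subst (λ q → Holdsᵛ q i) (≡.sym eq) (Equivalence.from (Holdsᵛ⇔Holds φ ρ i) h))))

    -- The ultrafilter is known to contain only those cofinite sets that are truth sets of formulas,
    -- so a formula has to be given.
    U-eventually : ∀ {n} (φ : Formula C n) ρ → ∃[ m ] (∀ i → m ≤ᴺ i → Holds φ ρ i) → U (Holds φ ρ)
    U-eventually {n} φ ρ (m , h) with proj₂ instances (n , φ , tabulate ρ)
    ... | k , eq = large {set = decided k}
      (proj₁ (proj₂ (proj₂ extension)) k (m , λ i m≤i → ⌞⌟-complete
        (≡.subst (λ q → Holdsᵛ q i) (≡.sym eq) (Equivalence.from (Holdsᵛ⇔Holds φ ρ i) (h i m≤i)))))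
      λ {i} t → Equivalence.to (Holdsᵛ⇔Holds φ ρ i)
        (≡.subst (λ q → Holdsᵛ q i) eq (⌞⌟-sound t))

    pattern v₀ = var (inj₂ zero)
    pattern v₁ = var (inj₂ (suc zero))
    pattern v₂ = var (inj₂ (suc (suc zero)))

    infixr 7 _∧ˢ_
    infixr 6 _∨ˢ_
    -- The operations are Skolem terms for the formulas that define their graphs, so the definable
    -- sequences are closed under them.
    _∧ˢ_ _∨ˢ_ : Skolem → Skolem → Skolem
    s ∧ˢ t = witness (v₀ ≐ v₁ ∧ᵗ v₂) (s ∷ t ∷ [])
    s ∨ˢ t = witness (v₀ ≐ v₁ ∨ᵗ v₂) (s ∷ t ∷ [])

    ~ˢ_ □ˢ_ : Skolem → Skolem
    ~ˢ s = witness (v₀ ≐ ~ᵗ v₁) (s ∷ [])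
    □ˢ s = witness (v₀ ≐ □ᵗ v₁) (s ∷ [])

    ⊤ˢ ⊥ˢ : Skolem
    ⊤ˢ = witness (v₀ ≐ ⊤ᵗ) []
    ⊥ˢ = witness (v₀ ≐ ⊥ᵗ) []

  constant : C → Skolem
  constant k = witness (v₀ ≐ var (inj₁ k)) []

  private
    value-∧ : ∀ i s t → N._≈_ i (value i (s ∧ˢ t)) (N._∧_ i (value i s) (value i t))
    value-∧ i s t = choose-sat i (v₀ ≐ v₁ ∧ᵗ v₂) (values i (s ∷ t ∷ [])) (N≈.refl i)

    value-∨ : ∀ i s t → N._≈_ i (value i (s ∨ˢ t)) (N._∨_ i (value i s) (value i t))
    value-∨ i s t = choose-sat i (v₀ ≐ v₁ ∨ᵗ v₂) (values i (s ∷ t ∷ [])) (N≈.refl i)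

    value-~ : ∀ i s → N._≈_ i (value i (~ˢ s)) (N.~_ i (value i s))
    value-~ i s = choose-sat i (v₀ ≐ ~ᵗ v₁) (values i (s ∷ [])) (N≈.refl i)

    value-□ : ∀ i s → N._≈_ i (value i (□ˢ s)) (N.□_ i (value i s))
    value-□ i s = choose-sat i (v₀ ≐ □ᵗ v₁) (values i (s ∷ [])) (N≈.refl i)

    value-constant : ∀ i k → N._≈_ i (value i (constant k)) (c i k)
    value-constant i k = choose-sat i (v₀ ≐ var (inj₁ k)) (values i []) (N≈.refl i)

  D : Structure
  D = record
    { Carrier = Skolem
    ; _≈_     = λ s t → U (λ i → N._≈_ i (value i s) (value i t))
    ; _∧_ = _∧ˢ_ ; _∨_ = _∨ˢ_ ; ~_ = ~ˢ_ ; □_ = □ˢ_ ; ⊤ = ⊤ˢ ; ⊥ = ⊥ˢ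
    ; isEquivalence = record
      { refl  = U-always λ i → N≈.refl i
      ; sym   = U-map λ i → N≈.sym i
      ; trans = U-map₂ λ i → N≈.trans i
      }
    ; ∧-cong = λ {s} {t} {u} {v} → U-map₂ λ i p q →
        N≈.trans i (value-∧ i s u) (N≈.trans i (N.∧-cong i p q) (N≈.sym i (value-∧ i t v)))
    ; ∨-cong = λ {s} {t} {u} {v} → U-map₂ λ i p q →
        N≈.trans i (value-∨ i s u) (N≈.trans i (N.∨-cong i p q) (N≈.sym i (value-∨ i t v)))
    ; ~-cong = λ {s} {t} → U-map λ i p →
        N≈.trans i (value-~ i s) (N≈.trans i (N.~-cong i p) (N≈.sym i (value-~ i t)))
    ; □-cong = λ {s} {t} → U-map λ i p →
        N≈.trans i (value-□ i s) (N≈.trans i (N.□-cong i p) (N≈.sym i (value-□ i t)))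
    }

  private
    value-⟦⟧ : ∀ i {n} (ρ : Fin n → Skolem) t →
      N._≈_ i (value i (⟦_⟧ D t [ constant , ρ ]′))
              (⟦_⟧ (N i) t [ c i , (λ j → value i (ρ j)) ]′)
    value-⟦⟧ i ρ (var (inj₁ k)) = value-constant i k
    value-⟦⟧ i ρ (var (inj₂ j)) = N≈.refl i
    value-⟦⟧ i ρ (s ∧ᵗ t) =
      N≈.trans i (value-∧ i (⟦_⟧ D s [ constant , ρ ]′) (⟦_⟧ D t [ constant , ρ ]′))
        (N.∧-cong i (value-⟦⟧ i ρ s) (value-⟦⟧ i ρ t))
    value-⟦⟧ i ρ (s ∨ᵗ t) =
      N≈.trans i (value-∨ i (⟦_⟧ D s [ constant , ρ ]′) (⟦_⟧ D t [ constant , ρ ]′))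
        (N.∨-cong i (value-⟦⟧ i ρ s) (value-⟦⟧ i ρ t))
    value-⟦⟧ i ρ (~ᵗ t)   = N≈.trans i (value-~ i (⟦_⟧ D t [ constant , ρ ]′)) (N.~-cong i (value-⟦⟧ i ρ t))
    value-⟦⟧ i ρ (□ᵗ t)   = N≈.trans i (value-□ i (⟦_⟧ D t [ constant , ρ ]′)) (N.□-cong i (value-⟦⟧ i ρ t))
    value-⟦⟧ i ρ ⊤ᵗ       = choose-sat i (v₀ ≐ ⊤ᵗ) (values i []) (N≈.refl i)
    value-⟦⟧ i ρ ⊥ᵗ       = choose-sat i (v₀ ≐ ⊥ᵗ) (values i []) (N≈.refl i)

    value-∷ᵉ : ∀ i {n} s (ρ : Fin n → Skolem) j →
               N._≈_ i (value i ((s ∷ᵉ ρ) j)) ((value i s ∷ᵉ (λ k → value i (ρ k))) j)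
    value-∷ᵉ i s ρ zero    = N≈.refl i
    value-∷ᵉ i s ρ (suc j) = N≈.refl i

  -- Henkin's device: one definable sequence refutes `φ` at every index where it can be refuted, so
  -- testing this one element of `D` decides `∀ᶠ φ`.
  counterexample : ∀ {n} → Formula C (suc n) → (Fin n → Skolem) → Skolem
  counterexample φ ρ = witness (¬ᶠ φ) (tabulate ρ)

  counterexample-sat : ∀ {n} (φ : Formula C (suc n)) ρ i →
                       Holds φ (counterexample φ ρ ∷ᵉ ρ) i → Holds (∀ᶠ φ) ρ i
  counterexample-sat φ ρ i h a = by-contradiction λ ¬φa →
    choose-sat i (¬ᶠ φ) (values i (tabulate ρ)) {a}
      (λ φa → ¬φa (Sat-cong (N i) (∷ᵉ-cong (N i) env≈) φ φa))
      (Sat-cong (N i) (λ j → N≈.trans i (value-∷ᵉ i (counterexample φ ρ) ρ j)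
        (∷ᵉ-cong (N i) (λ k → N≈.sym i (env≈ k)) j)) φ h)
    where
    env≈ : ∀ j → N._≈_ i (values i (tabulate ρ) j) (value i (ρ j))
    env≈ j = N≈.reflexive i (values-tabulate i ρ j)

  -- Induction on the formula. The implication needs the ultrafilter to decide the truth set of its
  -- premise, the quantifier needs `counterexample`.
  łoś : ∀ {n} (φ : Formula C n) ρ → Sat D constant ρ φ ⇔ U (Holds φ ρ)
  łoś (s ≐ t) ρ = mk⇔
    (U-map λ i eq → N≈.trans i (N≈.sym i (value-⟦⟧ i ρ s)) (N≈.trans i eq (value-⟦⟧ i ρ t)))
    (U-map λ i eq → N≈.trans i (value-⟦⟧ i ρ s) (N≈.trans i eq (N≈.sym i (value-⟦⟧ i ρ t))))
  łoś ⊥ᶠ ρ = mk⇔ (λ ()) U-nonempty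
  łoś (φ ⇒ ψ) ρ = mk⇔ to (λ imp p → Equivalence.from (łoś ψ ρ)
      (U-map₂ (λ i f → f) imp (Equivalence.to (łoś φ ρ) p)))
    where
    to : Sat D constant ρ (φ ⇒ ψ) → U (Holds (φ ⇒ ψ) ρ)
    to imp with U-decides φ ρ
    ... | inj₁ p  = U-map (λ i q _ → q)
                      (Equivalence.to (łoś ψ ρ) (imp (Equivalence.from (łoś φ ρ) p)))
    ... | inj₂ ¬p = U-map (λ i ¬φ h → ⊥-elim (¬φ h)) ¬p
  łoś (∀ᶠ φ) ρ = mk⇔
    (λ all → U-map (counterexample-sat φ ρ)
      (Equivalence.to (łoś φ (counterexample φ ρ ∷ᵉ ρ)) (all (counterexample φ ρ))))
    (λ u s → Equivalence.from (łoś φ (s ∷ᵉ ρ)) (U-map (λ i all →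
      Sat-cong (N i) (λ j → N≈.sym i (value-∷ᵉ i s ρ j)) φ (all (value i s))) u))

  eventually⇒D : ∀ (φ : Sentence C) → ∃[ m ] (∀ i → m ≤ᴺ i → _⊨ˢ_ (N i) (c i) φ) →
                 _⊨ˢ_ D constant φ
  eventually⇒D φ (m , h) = Equivalence.from (łoś φ (λ ())) (U-eventually φ (λ ())
    (m , λ i m≤i → Sat-cong (N i) (λ ()) φ (h i m≤i)))

-- A sentence that `T*` with the diagram of `P∞` does not decide

module NoModelCompletion (em : ∀ ℓ → ExcludedMiddle ℓ) (V : Variety)
         (extension : Bounds.FixpointExtension em V)
         (notWeaklyTransitive : ¬ WeaklyTransitive V)
         (T* : Theory Empty) (completion : IsModelCompletion T* (FirstOrderTheory V)) where
  open Bounds em V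
  open FixpointExtension extension
  open IsModelCompletion completion

  ∈ᵛ⇒model : ∀ {A} → A ∈ᵛ V → A ⊨ᴸ FirstOrderTheory V
  ∈ᵛ⇒model A∈V φ φ∈ = φ∈ _ A∈V

  private
    C = Term (Fin 2)

  N : ℕ → Structure
  N n = proj₁ (embeds (P n) (∈ᵛ⇒model (P∈ n)))

  N-model : ∀ n → N n ⊨ᴸ T*
  N-model n = proj₁ (proj₂ (embeds (P n) (∈ᵛ⇒model (P∈ n))))

  c : ∀ n → C → Structure.Carrier (N n)
  c n = proj₁ (proj₂ (proj₂ (embeds (P n) (∈ᵛ⇒model (P∈ n)))))

  c-embedding : ∀ n → IsEmbedding (P n) (N n) (c n)
  c-embedding n = proj₂ (proj₂ (proj₂ (embeds (P n) (∈ᵛ⇒model (P∈ n)))))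

  betweenImplies : ∀ {D n} → (x y z : Term (D ⊎ Fin n)) → Formula D n → Formula D n
  betweenImplies x y z φ = (y ≐ y ∧ᵗ x) ⇒ (x ≐ x ∧ᵗ z) ⇒ (x ≐ ⊡ x) ⇒ φ

  noneBetween : Sentence C
  noneBetween = ∀ᶠ (betweenImplies (var (inj₂ zero)) (var (inj₁ y)) (var (inj₁ z)) ⊥ᶠ)

  -- `N n` is given only as a model of `T*`, so `Between⊨` has to reach it as a sentence of the
  -- theory of `V`.
  betweenBound : ℕ → Sentence Empty
  betweenBound n = ∀ᶠ (∀ᶠ (∀ᶠ (betweenImplies x′ y′ z′ (y′ ≐ y′ ∧ᵗ ⊡^ (suc n) z′))))
    where
    x′ y′ z′ : Term (Empty ⊎ Fin 3)
    x′ = var (inj₂ zero)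
    y′ = var (inj₂ (suc zero))
    z′ = var (inj₂ (suc (suc zero)))

  betweenBound∈ : ∀ n → betweenBound n ∈ FirstOrderTheory V
  betweenBound∈ n A A∈V a b d p q r =
    Between⊨ V (var (inj₂ zero)) (var (inj₂ (suc zero))) (var (inj₂ (suc (suc zero)))) (suc n)
      A A∈V _ (p ∷ q ∷ r ∷ [])

  -- A fixpoint between `y` and `z` would force the bound for `suc n` in `N n`, and the embedding
  -- would reflect it to `P n`.
  N⊨noneBetween : ∀ n → _⊨ˢ_ (N n) (c n) noneBetween
  N⊨noneBetween n a p q r = notWeaklyTransitive (collapse n
    (≡.subst (λ t → y ≈[ n ] y ∧ᵗ t) P-⊡^
      (reflects (c-embedding n) (var zero) (var zero ∧ᵗ ⊡^ (suc n) (var (suc zero)))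
        (≡.subst (λ t → c n y N.≈ c n y N.∧ t)
          (⟦⊡^⟧-cong (N n) (var (inj₂ (suc (suc zero)))) z refl (suc n))
          (N-model n (betweenBound n) (extends (betweenBound∈ n)) (c n z) (c n y) a p q r)))))
    where
    module N = Structure (N n)
    P-⊡^ : ⟦_⟧ (P n) (⊡^ (suc n) z) var ≡ ⊡^ (suc n) z
    P-⊡^ = ≡.trans (⟦⟧-quotient {A = Free} var (⊡^ (suc n) z)) (⟦⟧-var (⊡^ (suc n) z))

  open SkolemLimit em {C} (termEncoding finEncoding) N c

  private
    none₀ : Fin 0 → C
    none₀ ()

    -- An equation true in `P∞` holds in `P i` from some stage on, and one false in `P∞` fails at
    -- every stage. Truth and falsity are treated together because an implication needs the falsity
    -- of its premise.
    P-stable : ∀ (φ : Sentence C) → QuantifierFree φ →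
               (Sat P∞ id none₀ φ → ∃[ m ] (∀ i → m ≤ᴺ i → Sat (P i) id none₀ φ)) ×
               (¬ Sat P∞ id none₀ φ → ∃[ m ] (∀ i → m ≤ᴺ i → ¬ Sat (P i) id none₀ φ))
    P-stable (s ≐ t) _ =
      (λ eq → let m , p = P∞-compact (P∞-⊨⁻ s t eq) in m , λ i m≤i → P-⊨ s t (later m≤i p)) ,
      (λ ≉ → 0 , λ i _ eq → ≉ (P∞-⊨ s t (P→P∞ (P-⊨⁻ s t eq))))
    P-stable ⊥ᶠ _ = (λ ()) , λ _ → 0 , λ _ _ ()
    P-stable (φ ⇒ ψ) (qφ , qψ) = holds , fails
      where
      open Classical em using (by-contradiction)
      φ-stable = P-stable φ qφ
      ψ-stable = P-stable ψ qψ
      holds : Sat P∞ id none₀ (φ ⇒ ψ) → ∃[ m ] (∀ i → m ≤ᴺ i → Sat (P i) id none₀ (φ ⇒ ψ))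
      holds imp with em _ {Sat P∞ id none₀ φ}
      ... | yes p = let m , h = proj₁ ψ-stable (imp p) in m , λ i m≤i _ → h i m≤i
      ... | no ¬p = let m , h = proj₂ φ-stable ¬p in m , λ i m≤i p → ⊥-elim (h i m≤i p)
      fails : ¬ Sat P∞ id none₀ (φ ⇒ ψ) → ∃[ m ] (∀ i → m ≤ᴺ i → ¬ Sat (P i) id none₀ (φ ⇒ ψ))
      fails ¬imp =
        let m , h = proj₁ φ-stable (by-contradiction λ ¬p → ¬imp λ p → ⊥-elim (¬p p))
            n , k = proj₂ ψ-stable λ q → ¬imp λ _ → q
        in m ⊔ n , λ i ≤i imp → k i (ℕ.≤-trans (ℕ.m≤n⊔m m n) ≤i)
                                  (imp (h i (ℕ.≤-trans (ℕ.m≤m⊔n m n) ≤i)))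

    D⊨diagram : ∀ φ → QuantifierFree φ → _⊨ˢ_ P∞ id φ → _⊨ˢ_ D constant φ
    D⊨diagram φ qφ sat =
      let m , h = proj₁ (P-stable φ qφ) (Sat-cong P∞ (λ ()) φ sat) in
      eventually⇒D φ (m , λ i m≤i →
        Equivalence.to (quantifierFree-⇔ (c-embedding i) none₀ _ φ qφ) (h i m≤i))

  D-model : IsModel (T* +Diagram P∞) D constant
  D-model φ (inj₁ (ψ , ψ∈T* , refl)) = eventually⇒D φ (0 , λ i _ →
    Equivalence.to (Sat-rename (N i) (λ ()) _ ψ) (N-model i ψ ψ∈T*))
  D-model φ (inj₂ (qφ , sat)) = D⊨diagram φ qφ sat

  D⊨noneBetween : _⊨ˢ_ D constant noneBetween
  D⊨noneBetween = eventually⇒D noneBetween (0 , λ i _ → N⊨noneBetween i)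

  modelCompletion-absurd : Empty
  modelCompletion-absurd with proj₂ (complete P∞ (∈ᵛ⇒model P∞∈)) noneBetween
  ... | inj₂ ⊨some = ⊨some D constant D-model D⊨noneBetween
  -- `B` need not be a model of `T*`, but it embeds into one, where the image of `x` is still a
  -- fixpoint between `y` and `z`.
  ... | inj₁ ⊨none with embeds B (∈ᵛ⇒model B∈V)
  ... | M , M-model , h , h-embedding =
    ⊨none M (h ∘ embed) model (h x)
      (≈.trans (cong y≤x) (∧-homo _ _))
      (≈.trans (cong x≤z) (∧-homo _ _))
      (≈.trans (cong x-fix) (≈.trans (∧-homo _ _) (∧-cong (□-homo _) ≈.refl)))
    where
    open Structure M using (∧-cong)
    module ≈ = IsEquivalence (Structure.isEquivalence M)
    open IsHomomorphism (proj₁ h-embedding)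
    model : IsModel (T* +Diagram P∞) M (h ∘ embed)
    model φ (inj₁ (ψ , ψ∈T* , refl)) =
      Equivalence.to (Sat-rename M (λ ()) _ ψ) (M-model ψ ψ∈T*)
    model φ (inj₂ (qφ , sat)) =
      Equivalence.to (quantifierFree-⇔ (∘-embedding h-embedding isEmbedding) _ _ φ qφ) sat

corollary5p4 : (∀ ℓ → ExcludedMiddle ℓ) →
    (V : Variety) →
    ClosedUnderCanonicalExtensions V →
    ¬ WeaklyTransitive V →
    ¬ Coherent V
    × ¬ RightUniformDeductiveInterpolation V
    × ¬ HasModelCompletion (FirstOrderTheory V)
corollary5p4 em V closed notWeaklyTransitive =
  notCoherent , noInterpolation ,
  λ (T* , completion) → NoModelCompletion.modelCompletion-absurd em V extension
                          notWeaklyTransitive T* completion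
  where
  extension = Bounds.fixpointExtension em V closed
  open Failures em V extension notWeaklyTransitive
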